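{- Let $(T,\ell)$ be a pair consisting of a rooted tree $T$ (not necessarily locally finite) and a length function $\ell$ on $T$, with metric realization $\Gamma$. Then the sequence $(a_n)$ produced by the greedy procedure depends only on $\Gamma$. That is: if $(T_1,\ell_1)$ and $(T_2,\ell_2)$ are two such pairs whose metric realizations are isometric by a root-preserving isometry (possibly $(T_1,\ell_1)=(T_2,\ell_2)$), and if $(\rho_n)$ and $(\rho'_n)$ are any sequences produced by the greedy procedure for $(T_1,\ell_1)$ and $(T_2,\ell_2)$ respectively, each continued as long as possible, then the associated sequences $(a_n)$ and $(a'_n)$ have the same (finite or infinite) length and $a_n=a'_n$ for every index $n$.
   Context: A rooted tree $T$ has root $\mathfrak r$; its edges are oriented away from the root and $E(T)$ denotes the set of oriented edges. A length function is a map $\ell:E(T)\to\mathbb R_{+}$ with (strictly) positive values. The metric realization $\Gamma$ of $(T,\ell)$ is the rooted metric tree obtained by replacing each edge $e$ with an interval of length $\ell(e)$ glued at its end-vertices, equipped with the path metric and rooted at $\mathfrak r$. A leaf of $T$ is a vertex $v\ne\mathfrak r$ of valence one; if $T$ consists of the single vertex $\mathfrak r$, then $\mathfrak r$ is a leaf. The boundary $\partial T$ is the set of infinite oriented paths starting at $\mathfrak r$. The extended boundary $\widetilde\partial T$ is the union of $\partial T$ and the set of oriented paths from $\mathfrak r$ to a leaf. For $\rho\in\widetilde\partial T$, $E(\rho)$ is the set of edges of $\rho$. For $\rho,\tau\in\widetilde\partial T$ (with $\rho\neq\tau$ if both are in $\partial T$), set $\langle\rho,\tau\rangle:=\sum_{e\in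 E(\rho)\cap E(\tau)}\ell(e)$. Greedy procedure: choose $\rho_0\in\widetilde\partial T$ arbitrarily and put $a_0=0$. Given $\rho_0,\dots,\rho_{n-1}$, choose, if possible, $\rho_n$ arbitrarily among the elements $\rho\in\widetilde\partial T\setminus\{\rho_0,\dots,\rho_{n-1}\}$ which minimize $\sum_{j=0}^{n-1}\langle\rho,\rho_j\rangle$, and set $a_n:=\sum_{j=0}^{n-1}\langle\rho_n,\rho_j\rangle$. If $\widetilde\partial T\setminus\{\rho_0,\dots,\rho_{n-1}\}$ is empty, the procedure stops. -}

module Defs where

open import Algebra.Bundles using (CommutativeRing)
open import Axiom.ExcludedMiddle using (ExcludedMiddle)
open import Data.List.Base using (List; []; _∷_; map; foldr; applyUpTo; catMaybes)
open import Data.List.Membership.Propositional using (_∈_)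
open import Data.List.Relation.Unary.Any using (Any)
open import Data.List.Relation.Unary.Unique.Propositional using (Unique)
open import Data.Maybe.Base as Maybe using (Maybe; just; nothing)
open import Data.Nat.Base using (ℕ; zero; suc)
open import Data.Product.Base using (Σ; ∃; _×_; _,_)
open import Data.Sum.Base using (_⊎_)
open import Function.Bundles using (Bijection; _⇔_)
open import Level using (Level; 0ℓ) renaming (suc to lsuc)
open import Relation.Binary.Bundles using (Setoid)
open import Relation.Binary.Construct.Closure.Equivalence as EqClosure using (EqClosure)
open import Relation.Binary.Construct.Closure.ReflexiveTransitive using (Star; ε; _◅_)
import Relation.Binary.Construct.StrictToNonStrict as StrictToNonStrict
open import Relation.Binary.Core using (Rel)
open import Relation.Binary.Definitions using (tri<; tri≈; tri>)
open import Relation.Binary.PropositionalEquality.Core using (_≡_; _≢_)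
open import Relation.Binary.Structures using (IsStrictTotalOrder)
open import Relation.Nullary.Decidable.Core using (Dec; yes; no)
open import Relation.Nullary.Negation.Core using (¬_)
open import Relation.Unary using (Pred)

-- The library has no real numbers.  Classically a Dedekind-complete ordered
-- field is unique up to a unique isomorphism, so a statement about every such
-- field is a statement about ℝ.

record CompleteOrderedField : Set₁ where
  infix 4 _<_
  field
    commutativeRing : CommutativeRing 0ℓ 0ℓ
  open CommutativeRing commutativeRing public
  field
    _<_                : Rel Carrier 0ℓ
    isStrictTotalOrder : IsStrictTotalOrder _≈_ _<_
    0<1                : 0# < 1#
    +-monoˡ-<          : ∀ x y z → x < y → x + z < y + z
    *-pos              : ∀ x y → 0# < x → 0# < y → 0# < x * y
    inverse            : ∀ x → ¬ (x ≈ 0#) → ∃ λ y → x * y ≈ 1#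
  open IsStrictTotalOrder isStrictTotalOrder public using (compare)
  open StrictToNonStrict _≈_ _<_ public using (_≤_)
  field
    supremum : (P : Pred Carrier 0ℓ) → ∃ P →
               (∃ λ b → ∀ x → P x → x ≤ b) →
               ∃ λ s → (∀ x → P x → x ≤ s) ×
                       (∀ b → (∀ x → P x → x ≤ b) → s ≤ b)

  ∣_∣ : Carrier → Carrier
  ∣ x ∣ with compare x 0#
  ... | tri< _ _ _ = - x
  ... | tri≈ _ _ _ = x
  ... | tri> _ _ _ = x

-- A rooted tree is given by its edges oriented away from the root: u ⟶ v is
-- the type of oriented edges from u to v, and Star _⟶_ u v is the type of
-- oriented paths from u to v.  The axiom makes the underlying unoriented graph
-- connected, without circuits, loops or multiple edges, and forces every edge
-- to point away from the root.  Valencies may be infinite.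

record RootedTree (v : Level) : Set (lsuc v) where
  infix 4 _⟶_
  field
    Vertex     : Set v
    _⟶_        : Rel Vertex v
    root       : Vertex
    path       : ∀ x → Star _⟶_ root x
    uniquePath : ∀ x (p q : Star _⟶_ root x) → p ≡ q

  record Edge : Set v where
    constructor edge
    field
      {source target} : Vertex
      arrow           : source ⟶ target

  open Edge public

  Incident : Edge → Vertex → Set v
  Incident e x = source e ≡ x ⊎ target e ≡ x

  ValenceOne : Vertex → Set v
  ValenceOne x = ∃ λ e → Incident e x × (∀ e′ → Incident e′ x → e′ ≡ e)

  IsLeaf : Vertex → Set v
  IsLeaf x = (x ≢ root × ValenceOne x) ⊎ (x ≡ root × (∀ y → y ≡ root))

  record Ray : Set v where
    field
      vertex : ℕ → Vertex
      start  : vertex 0 ≡ root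
      step   : ∀ n → vertex n ⟶ vertex (suc n)

  -- The extended boundary.
  data ∂̃ : Set v where
    ray  : Ray → ∂̃
    leaf : ∀ x → IsLeaf x → Star _⟶_ root x → ∂̃

  -- Equality of paths.  By uniquePath, rays with the same vertices have the
  -- same edges, and a path from the root is determined by its endpoint.
  infix 4 _≈∂_
  data _≈∂_ : Rel ∂̃ v where
    ray  : ∀ {r s} → (∀ n → Ray.vertex r n ≡ Ray.vertex s n) → ray r ≈∂ ray s
    leaf : ∀ {x y l m p q} → x ≡ y → leaf x l p ≈∂ leaf y m q

  pathEdges : ∀ {x y} → Star _⟶_ x y → List Edge
  pathEdges ε       = []
  pathEdges (a ◅ p) = edge a ∷ pathEdges p

  E : ∂̃ → Pred Edge v
  E (ray r)      e = ∃ λ n → e ≡ edge (Ray.step r n)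
  E (leaf _ _ p) e = e ∈ pathEdges p

module _ (ℝ : CompleteOrderedField) where
  open CompleteOrderedField ℝ

  record LengthTree (v : Level) : Set (lsuc v) where
    field
      tree : RootedTree v
    open RootedTree tree public
    field
      ℓ   : Edge → Carrier
      ℓ>0 : ∀ e → 0# < ℓ e

  module Realization {v : Level} (T : LengthTree v) where
    open LengthTree T

    -- onEdge e t is the point of the interval [0 , ℓ e] at distance t from
    -- the source of e.
    data Point : Set v where
      vertex : Vertex → Point
      onEdge : (e : Edge) (t : Carrier) → 0# ≤ t → t ≤ ℓ e → Point

    data Glue : Rel Point v where
      atSource : ∀ {e t p q} → t ≈ 0#  → Glue (onEdge e t p q) (vertex (source e))
      atTarget : ∀ {e t p q} → t ≈ ℓ e → Glue (onEdge e t p q) (vertex (target e))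
      sameCoordinate : ∀ {e s t p q p′ q′} → s ≈ t →
                       Glue (onEdge e s p q) (onEdge e t p′ q′)

    -- The points of Γ: the disjoint union of vertices and edge intervals, glued.
    Γ : Setoid v v
    Γ = EqClosure.setoid Glue

    infix 4 _≃_
    _≃_ : Rel Point v
    _≃_ = EqClosure Glue

    -- Paths in Γ made of finitely many segments, each inside one edge,
    -- indexed by their length.
    data PolygonalPath : Point → Point → Carrier → Set v where
      done : ∀ {x y} → x ≃ y → PolygonalPath x y 0#
      move : ∀ {x y d} e {s t p q p′ q′} → x ≃ onEdge e s p q →
             PolygonalPath (onEdge e t p′ q′) y d →
             PolygonalPath x y (∣ s - t ∣ + d)

    -- d is the distance from x to y in the path metric, i.e. the infimum of
    -- the lengths of paths from x to y.
    record IsDistance (x y : Point) (d : Carrier) : Set v where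
      field
        lowerBound : ∀ c → PolygonalPath x y c → d ≤ c
        greatest   : ∀ b → (∀ c → PolygonalPath x y c → b ≤ c) → b ≤ d

  record RootedIsometry {v : Level} (T₁ T₂ : LengthTree v) : Set v where
    private
      module T₁ = LengthTree T₁
      module T₂ = LengthTree T₂
      module Γ₁ = Realization T₁
      module Γ₂ = Realization T₂
    field
      bijection : Bijection Γ₁.Γ Γ₂.Γ
    open Bijection bijection public using (to)
    field
      isometric     : ∀ x y d → Γ₁.IsDistance x y d ⇔ Γ₂.IsDistance (to x) (to y) d
      rootPreserved : to (Γ₁.vertex T₁.root) Γ₂.≃ Γ₂.vertex T₂.root

  -- Excluded middle is needed to decide whether a set of edges is finite.
  module Greedy {v : Level} (em : ExcludedMiddle v) (T : LengthTree v) where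
    open LengthTree T

    Enumerates : List Edge → Pred Edge v → Set v
    Enumerates es P = Unique es × (∀ e → e ∈ es ⇔ P e)

    sumOver : {P : Pred Edge v} → Dec (∃ λ es → Enumerates es P) → Carrier
    sumOver (yes (es , _)) = foldr _+_ 0# (map ℓ es)
    sumOver (no _)         = 0#

    -- The sum of the lengths of the edges in P, with value 0 by convention
    -- when P is infinite.
    ∑ℓ : Pred Edge v → Carrier
    ∑ℓ P = sumOver {P} em

    -- E ρ ∩ E τ is infinite only when ρ and τ are the same ray; the greedy
    -- procedure only compares a path with different ones.
    ⟨_,_⟩ : ∂̃ → ∂̃ → Carrier
    ⟨ ρ , τ ⟩ = ∑ℓ (λ e → E ρ e × E τ e)

    -- The sum of ⟨ ρ , τ ⟩ over the list of earlier choices τ.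
    total : ∂̃ → List ∂̃ → Carrier
    total ρ τs = foldr (λ τ s → ⟨ ρ , τ ⟩ + s) 0# τs

    Fresh : List ∂̃ → Pred ∂̃ v
    Fresh τs ρ = ¬ Any (ρ ≈∂_) τs

    record IsChoice (τs : List ∂̃) (ρ : ∂̃) : Set v where
      field
        fresh   : Fresh τs ρ
        minimal : ∀ σ → Fresh τs σ → total ρ τs ≤ total σ τs

    -- A finite or infinite sequence produced by the procedure; ρ n ≡ nothing
    -- means that it has stopped before index n.  It may stop only when no
    -- choice exists, and then the list of earlier choices no longer changes,
    -- so that ρ is nothing from there on.
    record Run : Set v where
      field
        ρ : ℕ → Maybe ∂̃

      earlier : ℕ → List ∂̃
      earlier n = catMaybes (applyUpTo ρ n)

      field
        chosen  : ∀ n x → ρ n ≡ just x → IsChoice (earlier n) x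
        maximal : ∀ n → ρ n ≡ nothing → ∀ x → ¬ IsChoice (earlier n) x

      a : ℕ → Maybe Carrier
      a n = Maybe.map (λ x → total x (earlier n)) (ρ n)

{-# OPTIONS --safe #-}

-- The product of two different paths is the height of the vertex where they
-- part, so it is symmetric and satisfies p x y ≤ p x z or p y z ≤ p x z.  For
-- any such product two greedy sequences have the same values: from two choices
-- on, both contain a pair realizing the least product c, and the relation
-- "x ∼ y or c < p x y" cuts the space into branches inside which the choices
-- are again greedy.  Given k choices ρ, and k choices τ followed by one more
-- element x, some branch meets the second list more often than the first;
-- exchanging inside that branch, by induction on k, gives a new element for
-- the ρ whose total is at most that of x for the τ.
--
-- The realization enters through "x lies between the root and y", which holds
-- exactly when the distance from x to y is the difference of their heights.  An
-- isometry preserves this order and the heights, and paths to the extended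
-- boundary are the maximal chains of the order, so the extended boundaries
-- correspond, with the same products.
module Submission where

open import Defs
open import Algebra.Bundles using (CommutativeRing)
import Algebra.Properties.AbelianGroup as AbelianGroupProperties
import Algebra.Solver.CommutativeMonoid as CommutativeMonoidSolver
open import Axiom.ExcludedMiddle using (ExcludedMiddle)
open import Data.Empty using (⊥-elim)
open import Data.List.Base using (List; []; _∷_; _++_; map; foldr; length; filter; applyUpTo; catMaybes)
open import Data.List.Membership.Propositional using (_∈_; find; lose)
open import Data.List.Membership.Propositional.Properties using (∈-∃++; ∈-++⁺ˡ; ∈-++⁺ʳ; ∈-++⁻)
open import Data.List.Membership.Propositional.Properties.WithK using (unique∧set⇒bag)
open import Data.List.Properties
  using ( length-++; length-++-sucʳ; ++-identityʳ; filter-notAll; filter-accept; filter-reject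
        ; filter-none; applyUpTo-∷ʳ; catMaybes-++ )
open import Data.List.Relation.Binary.BagAndSetEquality using (∼bag⇒↭)
open import Data.List.Relation.Binary.Permutation.Propositional as ↭
  using (_↭_; ↭-refl; ↭-sym; ↭-trans; prep; swap)
open import Data.List.Relation.Binary.Permutation.Propositional.Properties using (Any-resp-↭; ∷↭∷ʳ)
open import Data.List.Relation.Binary.Pointwise using ([]; _∷_; Pointwise-length)
  renaming (Pointwise to PointwiseList)
open import Data.List.Relation.Unary.All as All using (All; []; _∷_)
import Data.List.Relation.Unary.All.Properties as All
open import Data.List.Relation.Unary.AllPairs using ([]; _∷_)
open import Data.List.Relation.Unary.Any as Any using (Any; here; there)
open import Data.List.Relation.Unary.Unique.Propositional using (Unique)
import Data.List.Relation.Unary.Unique.Propositional.Properties as Unique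
open import Data.Maybe.Base as Maybe using (Maybe; just; nothing)
open import Data.Maybe.Properties using (just-injective)
open import Data.Maybe.Relation.Binary.Pointwise using (Pointwise; just; nothing)
open import Data.Nat.Base as ℕ using (ℕ; zero; suc)
open import Data.Nat.Induction using (<-wellFounded)
import Data.Nat.Properties as ℕ
open import Data.Product.Base using (∃; ∃₂; _×_; _,_; proj₁; proj₂)
open import Data.Sum.Base as Sum using (_⊎_; inj₁; inj₂)
open import Data.Unit.Polymorphic.Base using (⊤; tt)
open import Function.Base using (_∘_; id)
open import Function.Bundles using (_⇔_; mk⇔; Equivalence; Bijection)
open import Function.Properties.Equivalence using () renaming (sym to ⇔-sym; trans to ⇔-trans)
open import Induction.WellFounded using (Acc; acc)
open import Level using (Level) renaming (suc to lsuc)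
open import Relation.Binary.Bundles using (Setoid; StrictPartialOrder)
import Relation.Binary.Construct.Closure.Equivalence as EqClosure
open import Relation.Binary.Construct.Closure.ReflexiveTransitive using (Star; ε; _◅_; _◅◅_)
import Relation.Binary.Construct.StrictToNonStrict as StrictToNonStrict
open import Relation.Binary.Core using (Rel)
open import Relation.Binary.Definitions using (Decidable; tri<; tri≈; tri>)
open import Relation.Binary.PropositionalEquality as ≡ using (_≡_; _≢_; refl; cong; sym; trans; subst)
import Relation.Binary.Reasoning.StrictPartialOrder as StrictPartialOrderReasoning
open import Relation.Binary.Structures using (IsEquivalence; IsStrictTotalOrder; IsTotalOrder)
open import Relation.Nullary using (Dec; yes; no; ¬_; contradiction)
open import Relation.Nullary.Decidable using (decidable-stable)
open import Relation.Unary using (Pred)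

-- The ordered field

module OrderedField (ℝ : CompleteOrderedField) where
  open CompleteOrderedField ℝ public
    using ( Carrier; _≈_; _+_; -_; _-_; 0#; _<_; _≤_; ∣_∣; compare; +-monoˡ-<
          ; +-assoc; +-comm; +-cong; +-congˡ; +-congʳ; +-identityˡ; +-identityʳ
          ; -‿inverseʳ )
    renaming (refl to ≈-refl; sym to ≈-sym; trans to ≈-trans; isEquivalence to ≈-isEquivalence)
  open CompleteOrderedField ℝ using (isStrictTotalOrder; commutativeRing)
  open CommutativeRing commutativeRing using (+-commutativeMonoid; +-abelianGroup)
  open AbelianGroupProperties +-abelianGroup using (⁻¹-anti-homo-//)

  open CommutativeMonoidSolver +-commutativeMonoid public using (solve; _⊕_; _⊜_)

  open IsStrictTotalOrder isStrictTotalOrder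
    using (isStrictPartialOrder; irrefl)
  open IsStrictTotalOrder isStrictTotalOrder public using (<-respʳ-≈)
  open StrictToNonStrict _≈_ _<_ using (isTotalOrder)

  private
    strictPartialOrder : StrictPartialOrder _ _ _
    strictPartialOrder = record { isStrictPartialOrder = isStrictPartialOrder }

  module ≤-Reasoning = StrictPartialOrderReasoning strictPartialOrder
  open ≤-Reasoning

  open IsTotalOrder (isTotalOrder isStrictTotalOrder) public
    using () renaming (trans to ≤-trans; total to ≤-total; antisym to ≤-antisym; refl to ≤-refl)

  ≮⇒≥ : ∀ {x y} → ¬ (x < y) → y ≤ x
  ≮⇒≥ {x} {y} x≮y with compare x y
  ... | tri< x<y _ _ = ⊥-elim (x≮y x<y)
  ... | tri≈ _ x≈y _ = inj₂ (≈-sym x≈y)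
  ... | tri> _ _ y<x = inj₁ y<x

  <⇒≱ : ∀ {x y} → x < y → ¬ (y ≤ x)
  <⇒≱ {x} {y} x<y y≤x = irrefl ≈-refl (begin-strict x <⟨ x<y ⟩ y ≤⟨ y≤x ⟩ x ∎)

  <-irrefl : ∀ {x} → ¬ (x < x)
  <-irrefl = irrefl ≈-refl

  _<?_ : ∀ x y → Dec (x < y)
  x <? y with compare x y
  ... | tri< x<y _ _ = yes x<y
  ... | tri≈ x≮y _ _ = no x≮y
  ... | tri> x≮y _ _ = no x≮y

  +-monoʳ-< : ∀ z {x y} → x < y → z + x < z + y
  +-monoʳ-< z {x} {y} x<y = begin-strict
    z + x ≈⟨ +-comm z x ⟩ x + z <⟨ +-monoˡ-< x y z x<y ⟩ y + z ≈⟨ +-comm y z ⟩ z + y ∎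

  +-monoˡ-≤ : ∀ z {x y} → x ≤ y → x + z ≤ y + z
  +-monoˡ-≤ z (inj₁ x<y) = inj₁ (+-monoˡ-< _ _ z x<y)
  +-monoˡ-≤ z (inj₂ x≈y) = inj₂ (+-congʳ x≈y)

  +-monoʳ-≤ : ∀ z {x y} → x ≤ y → z + x ≤ z + y
  +-monoʳ-≤ z (inj₁ x<y) = inj₁ (+-monoʳ-< z x<y)
  +-monoʳ-≤ z (inj₂ x≈y) = inj₂ (+-congˡ x≈y)

  +-mono-≤ : ∀ {w x y z} → w ≤ x → y ≤ z → w + y ≤ x + z
  +-mono-≤ {w} {x} {y} {z} w≤x y≤z = ≤-trans (+-monoˡ-≤ y w≤x) (+-monoʳ-≤ x y≤z)

  +-cancelˡ-≤ : ∀ z {x y} → z + x ≤ z + y → x ≤ y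
  +-cancelˡ-≤ z {x} {y} z+x≤z+y = ≮⇒≥ λ y<x → <⇒≱ (+-monoʳ-< z y<x) z+x≤z+y

  +-cancelʳ-≤ : ∀ z {x y} → x + z ≤ y + z → x ≤ y
  +-cancelʳ-≤ z {x} {y} x+z≤y+z = ≮⇒≥ λ y<x → <⇒≱ (+-monoˡ-< _ _ z y<x) x+z≤y+z

  x≤x+y : ∀ x {y} → 0# ≤ y → x ≤ x + y
  x≤x+y x {y} 0≤y = begin x ≈⟨ +-identityʳ x ⟨ x + 0# ≤⟨ +-monoʳ-≤ x 0≤y ⟩ x + y ∎

  x≤y+x : ∀ x {y} → 0# ≤ y → x ≤ y + x
  x≤y+x x {y} 0≤y = begin x ≤⟨ x≤x+y x 0≤y ⟩ x + y ≈⟨ +-comm x y ⟩ y + x ∎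

  x<x+y : ∀ x {y} → 0# < y → x < x + y
  x<x+y x {y} 0<y = begin-strict x ≈⟨ +-identityʳ x ⟨ x + 0# <⟨ +-monoʳ-< x 0<y ⟩ x + y ∎

  x+[y-x]≈y : ∀ x y → x + (y - x) ≈ y
  x+[y-x]≈y x y = begin-equality
    x + (y - x)  ≈⟨ solve 3 (λ a b c → a ⊕ (b ⊕ c) ⊜ b ⊕ (a ⊕ c)) ≈-refl x y (- x) ⟩
    y + (x - x)  ≈⟨ +-congˡ (-‿inverseʳ x) ⟩
    y + 0#       ≈⟨ +-identityʳ y ⟩
    y            ∎

  0≤y-x : ∀ {x y} → x ≤ y → 0# ≤ y - x
  0≤y-x {x} {y} x≤y = +-cancelˡ-≤ x (begin
    x + 0# ≈⟨ +-identityʳ x ⟩ x ≤⟨ x≤y ⟩ y ≈⟨ x+[y-x]≈y x y ⟨ x + (y - x) ∎)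

  x-y≤0 : ∀ {x y} → x ≤ y → x - y ≤ 0#
  x-y≤0 {x} {y} x≤y = +-cancelˡ-≤ y (begin
    y + (x - y) ≈⟨ x+[y-x]≈y y x ⟩ x ≤⟨ x≤y ⟩ y ≈⟨ +-identityʳ y ⟨ y + 0# ∎)

  x≤0⇒0≤-x : ∀ {x} → x ≤ 0# → 0# ≤ - x
  x≤0⇒0≤-x {x} x≤0 = begin 0# ≤⟨ 0≤y-x x≤0 ⟩ 0# - x ≈⟨ +-identityˡ (- x) ⟩ - x ∎

  0≤x⇒-x≤0 : ∀ {x} → 0# ≤ x → - x ≤ 0#
  0≤x⇒-x≤0 {x} 0≤x = begin - x ≈⟨ +-identityˡ (- x) ⟨ 0# - x ≤⟨ x-y≤0 0≤x ⟩ 0# ∎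

  x≤∣x∣ : ∀ x → x ≤ ∣ x ∣
  x≤∣x∣ x with compare x 0#
  ... | tri< x<0 _ _ = ≤-trans (inj₁ x<0) (x≤0⇒0≤-x (inj₁ x<0))
  ... | tri≈ _ _ _   = ≤-refl
  ... | tri> _ _ _   = ≤-refl

  -x≤∣x∣ : ∀ x → - x ≤ ∣ x ∣
  -x≤∣x∣ x with compare x 0#
  ... | tri< _ _ _   = ≤-refl
  ... | tri≈ _ x≈0 _ = ≤-trans (0≤x⇒-x≤0 (inj₂ (≈-sym x≈0))) (inj₂ (≈-sym x≈0))
  ... | tri> _ _ 0<x = ≤-trans (0≤x⇒-x≤0 (inj₁ 0<x)) (inj₁ 0<x)

  ∣x∣≤ : ∀ {x y} → x ≤ y → - x ≤ y → ∣ x ∣ ≤ y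
  ∣x∣≤ {x} x≤y -x≤y with compare x 0#
  ... | tri< _ _ _ = -x≤y
  ... | tri≈ _ _ _ = x≤y
  ... | tri> _ _ _ = x≤y

  0≤∣x∣ : ∀ x → 0# ≤ ∣ x ∣
  0≤∣x∣ x with ≤-total 0# x
  ... | inj₁ 0≤x = ≤-trans 0≤x (x≤∣x∣ x)
  ... | inj₂ x≤0 = ≤-trans (x≤0⇒0≤-x x≤0) (-x≤∣x∣ x)

  x≤y+∣x-y∣ : ∀ x y → x ≤ y + ∣ x - y ∣
  x≤y+∣x-y∣ x y = begin
    x             ≈⟨ x+[y-x]≈y y x ⟨
    y + (x - y)   ≤⟨ +-monoʳ-≤ y (x≤∣x∣ (x - y)) ⟩
    y + ∣ x - y ∣ ∎

  y≤x+∣x-y∣ : ∀ x y → y ≤ x + ∣ x - y ∣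
  y≤x+∣x-y∣ x y = begin
    y               ≈⟨ x+[y-x]≈y x y ⟨
    x + (y - x)     ≈⟨ +-congˡ (⁻¹-anti-homo-// x y) ⟨
    x + (- (x - y)) ≤⟨ +-monoʳ-≤ x (-x≤∣x∣ (x - y)) ⟩
    x + ∣ x - y ∣   ∎

  ∣x-y∣≤ : ∀ {x y z} → x ≤ y + z → y ≤ x + z → ∣ x - y ∣ ≤ z
  ∣x-y∣≤ {x} {y} {z} x≤y+z y≤x+z = ∣x∣≤
    (+-cancelˡ-≤ y (begin y + (x - y) ≈⟨ x+[y-x]≈y y x ⟩ x ≤⟨ x≤y+z ⟩ y + z ∎))
    (+-cancelˡ-≤ x (begin
      x + (- (x - y)) ≈⟨ +-congˡ (⁻¹-anti-homo-// x y) ⟩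
      x + (y - x)     ≈⟨ x+[y-x]≈y x y ⟩
      y               ≤⟨ y≤x+z ⟩
      x + z           ∎))

  x≤y⇒x+∣x-y∣≈y : ∀ {x y} → x ≤ y → x + ∣ x - y ∣ ≈ y
  x≤y⇒x+∣x-y∣≈y {x} {y} x≤y = ≤-antisym
    (begin
      x + ∣ x - y ∣ ≤⟨ +-monoʳ-≤ x (∣x-y∣≤ (≤-trans x≤y (x≤x+y y 0≤y-x′)) (inj₂ (≈-sym (x+[y-x]≈y x y)))) ⟩
      x + (y - x)   ≈⟨ x+[y-x]≈y x y ⟩
      y             ∎)
    (y≤x+∣x-y∣ x y)
    where
    0≤y-x′ : 0# ≤ y - x
    0≤y-x′ = 0≤y-x x≤y

  ∣x-y∣-triangle : ∀ x y z → ∣ x - z ∣ ≤ ∣ x - y ∣ + ∣ y - z ∣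
  ∣x-y∣-triangle x y z = ∣x-y∣≤
    (begin
      x                                 ≤⟨ x≤y+∣x-y∣ x y ⟩
      y + ∣ x - y ∣                     ≤⟨ +-monoˡ-≤ _ (x≤y+∣x-y∣ y z) ⟩
      (z + ∣ y - z ∣) + ∣ x - y ∣       ≈⟨ solve 3 (λ a b c → (a ⊕ b) ⊕ c ⊜ a ⊕ (c ⊕ b)) ≈-refl _ _ _ ⟩
      z + (∣ x - y ∣ + ∣ y - z ∣)       ∎)
    (begin
      z                                 ≤⟨ y≤x+∣x-y∣ y z ⟩
      y + ∣ y - z ∣                     ≤⟨ +-monoˡ-≤ _ (y≤x+∣x-y∣ x y) ⟩
      (x + ∣ x - y ∣) + ∣ y - z ∣       ≈⟨ +-assoc _ _ _ ⟩
      x + (∣ x - y ∣ + ∣ y - z ∣)       ∎)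

  ∣x-y∣-congʳ : ∀ {x y z} → y ≈ z → ∣ x - y ∣ ≈ ∣ x - z ∣
  ∣x-y∣-congʳ {x} y≈z = ≤-antisym (half y≈z) (half (≈-sym y≈z))
    where
    half : ∀ {y z} → y ≈ z → ∣ x - y ∣ ≤ ∣ x - z ∣
    half {y} {z} y≈z = ∣x-y∣≤
      (begin x ≤⟨ x≤y+∣x-y∣ x z ⟩ z + ∣ x - z ∣ ≈⟨ +-congʳ y≈z ⟨ y + ∣ x - z ∣ ∎)
      (begin y ≈⟨ y≈z ⟩ z ≤⟨ y≤x+∣x-y∣ x z ⟩ x + ∣ x - z ∣ ∎)

  ∣x-0∣≈x : ∀ {x} → 0# ≤ x → ∣ x - 0# ∣ ≈ x
  ∣x-0∣≈x {x} 0≤x = ≤-antisym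
    (∣x-y∣≤ (inj₂ (≈-sym (+-identityˡ x))) (≤-trans 0≤x (x≤x+y x 0≤x)))
    (begin x ≤⟨ x≤y+∣x-y∣ x 0# ⟩ 0# + ∣ x - 0# ∣ ≈⟨ +-identityˡ _ ⟩ ∣ x - 0# ∣ ∎)

  infixl 7 _·_
  _·_ : ℕ → Carrier → Carrier
  zero  · c = 0#
  suc n · c = c + n · c

  ·-mono-≤ : ∀ {c} → 0# ≤ c → ∀ {m n} → m ℕ.≤ n → m · c ≤ n · c
  ·-mono-≤ 0≤c {n = zero}  ℕ.z≤n       = ≤-refl
  ·-mono-≤ 0≤c {n = suc n} ℕ.z≤n       = ≤-trans (·-mono-≤ 0≤c {n = n} ℕ.z≤n) (x≤y+x _ 0≤c)
  ·-mono-≤ 0≤c             (ℕ.s≤s m≤n) = +-monoʳ-≤ _ (·-mono-≤ 0≤c m≤n)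

-- Greedy sequences for an abstract product

module _ (ℝ : CompleteOrderedField) where
  open OrderedField ℝ

  -- p is a Gromov product, meaningful only at pairs of different elements.
  record ProductSpace (v : Level) : Set (lsuc v) where
    infix 4 _∼_
    field
      X             : Set v
      _∼_           : Rel X v
      isEquivalence : IsEquivalence _∼_
      _∼?_          : Decidable _∼_
      p             : X → X → Carrier
      p-nonneg      : ∀ {x y} → ¬ x ∼ y → 0# ≤ p x y
      p-sym         : ∀ {x y} → ¬ x ∼ y → p x y ≈ p y x
      p-congʳ       : ∀ {x y z} → ¬ x ∼ y → y ∼ z → p x y ≈ p x z
      p-ultrametric : ∀ {x y z} → ¬ x ∼ y → ¬ y ∼ z → ¬ x ∼ z →
                      p x y ≤ p x z ⊎ p y z ≤ p x z
    open IsEquivalence isEquivalence public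
      renaming (refl to ∼-refl; sym to ∼-sym; trans to ∼-trans)

  module GreedySequences {v : Level} (S : ProductSpace v) where
    open ProductSpace S
    open ≤-Reasoning

    tot : X → List X → Carrier
    tot x ts = foldr (λ t s → p x t + s) 0# ts

    Apart : X → List X → Set v
    Apart x ts = All (λ t → ¬ x ∼ t) ts

    -- Latest choice first, with all choices restricted to B.
    record Choice (B : Pred X v) (ts : List X) (x : X) : Set v where
      constructor choice
      field
        inside  : B x
        apart   : Apart x ts
        minimal : ∀ y → B y → Apart y ts → tot x ts ≤ tot y ts

    data IsGreedy (B : Pred X v) : List X → Set v where
      []  : IsGreedy B []
      _∷_ : ∀ {x ts} → Choice B ts x → IsGreedy B ts → IsGreedy B (x ∷ ts)

    Greedy⇒All : ∀ {B ts} → IsGreedy B ts → All B ts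
    Greedy⇒All []      = []
    Greedy⇒All (c ∷ g) = Choice.inside c ∷ Greedy⇒All g

    IsGreedy-suffix : ∀ {B} ts {us} → IsGreedy B (ts ++ us) → IsGreedy B us
    IsGreedy-suffix []       g       = g
    IsGreedy-suffix (_ ∷ ts) (_ ∷ g) = IsGreedy-suffix ts g

    tot-nonneg : ∀ {x} ts → Apart x ts → 0# ≤ tot x ts
    tot-nonneg []       []         = ≤-refl
    tot-nonneg (t ∷ ts) (x≁t ∷ ap) = ≤-trans (tot-nonneg ts ap) (x≤y+x _ (p-nonneg x≁t))

    -- The extra element `x` need not be a greedy choice, so `x ∷ ts` need not be greedy. What the
    -- exchange uses about an entry `t` of it, chosen or extra, is collected here.
    suffix-greedy : ∀ {B x t ts} us {vs} → IsGreedy B ts → B x → Apart x ts →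
                    x ∷ ts ≡ us ++ t ∷ vs → B t × Apart t vs × IsGreedy B vs
    suffix-greedy []       g Bx x≁ refl = Bx , x≁ , g
    suffix-greedy (_ ∷ us) g Bx x≁ refl with IsGreedy-suffix us g
    ... | choice Bt t≁ _ ∷ g′ = Bt , t≁ , g′

    -- The second choice realizes the least product of two different elements.
    leastProduct : ∀ {B a b ts} → IsGreedy B (a ∷ b ∷ ts) →
                   ∃₂ λ c d → c ∈ (a ∷ b ∷ ts) × d ∈ (a ∷ b ∷ ts) × ¬ c ∼ d ×
                     (∀ {x y} → B x → B y → ¬ x ∼ y → p c d ≤ p x y)
    leastProduct {B} {a} {b} {[]} (choice _ (a≁b ∷ []) min ∷ choice Bb _ _ ∷ []) =
      a , b , here refl , there (here refl) , a≁b , least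
      where
      toB : ∀ {x} → B x → ¬ x ∼ b → p a b ≤ p x b
      toB {x} Bx x≁b = +-cancelʳ-≤ 0# (min x Bx (x≁b ∷ []))

      least : ∀ {x y} → B x → B y → ¬ x ∼ y → p a b ≤ p x y
      least {x} {y} Bx By x≁y with x ∼? b | y ∼? b
      ... | _ | yes y∼b = begin
        p a b ≤⟨ toB Bx (λ x∼b → x≁y (∼-trans x∼b (∼-sym y∼b))) ⟩
        p x b ≈⟨ p-congʳ x≁y y∼b ⟨
        p x y ∎
      ... | yes x∼b | no y≁b = begin
        p a b ≤⟨ toB By y≁b ⟩
        p y b ≈⟨ p-congʳ (x≁y ∘ ∼-sym) x∼b ⟨
        p y x ≈⟨ p-sym (x≁y ∘ ∼-sym) ⟩
        p x y ∎
      -- One of the products of `x` and `y` with `b` is at most `p x y`, and `a` minimizes the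
      -- product with `b`.
      ... | no x≁b | no y≁b with p-ultrametric x≁b (y≁b ∘ ∼-sym) x≁y
      ...   | inj₁ xb≤xy = ≤-trans (toB Bx x≁b) xb≤xy
      ...   | inj₂ by≤xy = begin
        p a b ≤⟨ toB By y≁b ⟩
        p y b ≈⟨ p-sym y≁b ⟩
        p b y ≤⟨ by≤xy ⟩
        p x y ∎
    leastProduct {ts = _ ∷ _} (_ ∷ g@(_ ∷ _ ∷ _)) with leastProduct g
    ... | c , d , c∈ , d∈ , c≁d , least = c , d , there c∈ , there d∈ , c≁d , least

    -- Every entry of `us` contributes at least `c`. Lengths appear on both sides so that no natural
    -- numbers are subtracted.
    tot-suffix : ∀ {c x} us {vs} → Apart x (us ++ vs) →
                 (∀ {t} → t ∈ (us ++ vs) → c ≤ p x t) →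
                 tot x vs + length (us ++ vs) · c ≤ tot x (us ++ vs) + length vs · c
    tot-suffix         []            ap       c≤ = ≤-refl
    tot-suffix {c} {x} (u ∷ us) {vs} (_ ∷ ap) c≤ = begin
      tot x vs + (c + length (us ++ vs) · c)        ≈⟨ solve 3 (λ a b d → a ⊕ (b ⊕ d) ⊜ b ⊕ (a ⊕ d)) ≈-refl _ _ _ ⟩
      c + (tot x vs + length (us ++ vs) · c)        ≤⟨ +-mono-≤ (c≤ (here refl)) (tot-suffix us ap (c≤ ∘ there)) ⟩
      p x u + (tot x (us ++ vs) + length vs · c)    ≈⟨ +-assoc _ _ _ ⟨
      (p x u + tot x (us ++ vs)) + length vs · c    ∎

    -- The classes of _≋_ are the branches of B at height c.
    module Branch (c : Carrier) (B : Pred X v)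
                  (least : ∀ {x y} → B x → B y → ¬ x ∼ y → c ≤ p x y) where

      infix 4 _≋_ _≋?_
      _≋_ : Rel X v
      x ≋ y = x ∼ y ⊎ (¬ x ∼ y × c < p x y)

      _≋?_ : Decidable _≋_
      x ≋? y with x ∼? y | c <? p x y
      ... | yes x∼y | _        = yes (inj₁ x∼y)
      ... | no x≁y  | yes c<xy = yes (inj₂ (x≁y , c<xy))
      ... | no x≁y  | no c≮xy  = no λ { (inj₁ x∼y) → x≁y x∼y ; (inj₂ (_ , c<xy)) → c≮xy c<xy }

      ≋-sym : ∀ {x y} → x ≋ y → y ≋ x
      ≋-sym (inj₁ x∼y)          = inj₁ (∼-sym x∼y)
      ≋-sym (inj₂ (x≁y , c<xy)) = inj₂ (x≁y ∘ ∼-sym , <-respʳ-≈ (p-sym x≁y) c<xy)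

      -- By the ultrametric inequality `p x z` is at least `p x y` or `p y z`, hence above `c`.
      -- Pairs related by `∼` are split off because `p` is meaningless there.
      ≋-trans : ∀ {x y z} → x ≋ y → y ≋ z → x ≋ z
      ≋-trans {x} {y} {z} x≋y y≋z with x ∼? z
      ... | yes x∼z = inj₁ x∼z
      ... | no x≁z with x≋y | y≋z
      ...   | inj₁ x∼y | inj₁ y∼z = inj₁ (∼-trans x∼y y∼z)
      ...   | inj₁ x∼y | inj₂ (y≁z , c<yz) = inj₂ (x≁z , (begin-strict
              c <⟨ c<yz ⟩ p y z ≈⟨ p-sym y≁z ⟩ p z y ≈⟨ p-congʳ (y≁z ∘ ∼-sym) (∼-sym x∼y) ⟩
              p z x ≈⟨ p-sym (x≁z ∘ ∼-sym) ⟩ p x z ∎))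
      ...   | inj₂ (x≁y , c<xy) | inj₁ y∼z = inj₂ (x≁z , <-respʳ-≈ (p-congʳ x≁y y∼z) c<xy)
      ...   | inj₂ (x≁y , c<xy) | inj₂ (y≁z , c<yz) with p-ultrametric x≁y y≁z x≁z
      ...     | inj₁ xy≤xz = inj₂ (x≁z , (begin-strict c <⟨ c<xy ⟩ p x y ≤⟨ xy≤xz ⟩ p x z ∎))
      ...     | inj₂ yz≤xz = inj₂ (x≁z , (begin-strict c <⟨ c<yz ⟩ p y z ≤⟨ yz≤xz ⟩ p x z ∎))

      p-across : ∀ {x y} → B x → B y → ¬ x ≋ y → p x y ≈ c
      p-across Bx By x≭y = ≤-antisym
        (≮⇒≥ λ c<xy → x≭y (inj₂ (x≭y ∘ inj₁ , c<xy)))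
        (least Bx By (x≭y ∘ inj₁))

      Class : X → Pred X v
      Class z y = B y × z ≋ y

      inClass : X → List X → List X
      inClass z = filter (z ≋?_)

      -- An entry outside the branch contributes exactly `c`, by `p-across`. Hence the totals over
      -- `ts` and over its part in the branch differ by an amount that is the same for all `y` in
      -- the branch.
      tot-inClass : ∀ {z y} ts → Class z y → All B ts →
                    tot y ts + length (inClass z ts) · c ≈ tot y (inClass z ts) + length ts · c
      tot-inClass []       _  [] = ≈-refl
      tot-inClass {z} {y} (t ∷ ts) Cy@(By , z≋y) (Bt ∷ Bts) with z ≋? t
      ... | yes _ = begin-equality
        (p y t + tot y ts) + (c + n · c)  ≈⟨ solve 4 (λ a b d e → (a ⊕ b) ⊕ (d ⊕ e) ⊜ (a ⊕ d) ⊕ (b ⊕ e)) ≈-refl _ _ _ _ ⟩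
        (p y t + c) + (tot y ts + n · c)  ≈⟨ +-congˡ (tot-inClass ts Cy Bts) ⟩
        (p y t + c) + (tot y us + length ts · c) ≈⟨ solve 4 (λ a b d e → (a ⊕ d) ⊕ (b ⊕ e) ⊜ (a ⊕ b) ⊕ (d ⊕ e)) ≈-refl _ _ _ _ ⟩
        (p y t + tot y us) + (c + length ts · c) ∎
        where
        us = inClass z ts
        n = length us
      ... | no z≭t = begin-equality
        (p y t + tot y ts) + n · c   ≈⟨ +-congʳ (+-congʳ (p-across By Bt λ y≋t → z≭t (≋-trans z≋y y≋t))) ⟩
        (c + tot y ts) + n · c       ≈⟨ +-assoc _ _ _ ⟩
        c + (tot y ts + n · c)       ≈⟨ +-congˡ (tot-inClass ts Cy Bts) ⟩
        c + (tot y us + length ts · c) ≈⟨ solve 3 (λ a b d → a ⊕ (b ⊕ d) ⊜ b ⊕ (a ⊕ d)) ≈-refl _ _ _ ⟩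
        tot y us + (c + length ts · c) ∎
        where
        us = inClass z ts
        n = length us

      tot-inClass-≤ : ∀ {z x y} ts → All B ts → Class z x → Class z y →
                      tot x ts ≤ tot y ts → tot x (inClass z ts) ≤ tot y (inClass z ts)
      tot-inClass-≤ {z} {x} {y} ts Bts Cx Cy x≤y = +-cancelʳ-≤ (length ts · c) (begin
        tot x (inClass z ts) + length ts · c ≈⟨ tot-inClass ts Cx Bts ⟨
        tot x ts + length (inClass z ts) · c ≤⟨ +-monoˡ-≤ _ x≤y ⟩
        tot y ts + length (inClass z ts) · c ≈⟨ tot-inClass ts Cy Bts ⟩
        tot y (inClass z ts) + length ts · c ∎)

      Apart-inClass⁺ : ∀ {z y} ts → Apart y ts → Apart y (inClass z ts)
      Apart-inClass⁺ {z} ts = All.filter⁺ (z ≋?_)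

      Apart-inClass⁻ : ∀ {z y} ts → z ≋ y → Apart y (inClass z ts) → Apart y ts
      Apart-inClass⁻ []       _   _  = []
      Apart-inClass⁻ {z} (t ∷ ts) z≋y ap with z ≋? t | ap
      ... | yes _  | y≁t ∷ ap′ = y≁t ∷ Apart-inClass⁻ ts z≋y ap′
      ... | no z≭t | ap′ = (λ y∼t → z≭t (≋-trans z≋y (inj₁ y∼t))) ∷ Apart-inClass⁻ ts z≋y ap′

      -- Passing to the branch shifts the totals of all its elements by the same amount, so a choice
      -- that lies in the branch stays minimal there.
      IsGreedy-inClass : ∀ {ts} z → IsGreedy B ts → IsGreedy (Class z) (inClass z ts)
      IsGreedy-inClass z []      = []
      IsGreedy-inClass {t ∷ ts} z (choice Bt t≁ts min ∷ g) with z ≋? t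
      ... | no _    = IsGreedy-inClass z g
      ... | yes z≋t = choice (Bt , z≋t) (Apart-inClass⁺ ts t≁ts)
        (λ y Cy@(By , z≋y) y≁ → tot-inClass-≤ ts (Greedy⇒All g) (Bt , z≋t) Cy
          (min y By (Apart-inClass⁻ ts z≋y y≁)))
        ∷ IsGreedy-inClass z g

      #_∈_ : X → List X → ℕ
      # z ∈ ts = length (inClass z ts)

      #-here : ∀ {z t} ts → z ≋ t → # z ∈ (t ∷ ts) ≡ suc (# z ∈ ts)
      #-here {z} ts z≋t = cong length (filter-accept (z ≋?_) z≋t)

      #-remove : ∀ {z t} us vs → z ≋ t → # z ∈ (us ++ t ∷ vs) ≡ suc (# z ∈ (us ++ vs))
      #-remove         []       vs z≋t = #-here vs z≋t
      #-remove {z} (u ∷ us) vs z≋t with z ≋? u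
      ... | yes _ = cong suc (#-remove us vs z≋t)
      ... | no  _ = #-remove us vs z≋t

      #-keep : ∀ {z t} us vs → ¬ z ≋ t → # z ∈ (us ++ t ∷ vs) ≡ # z ∈ (us ++ vs)
      #-keep {z} []       vs z≭t = cong length (filter-reject (z ≋?_) z≭t)
      #-keep {z} (u ∷ us) vs z≭t with z ≋? u
      ... | yes _ = cong suc (#-keep us vs z≭t)
      ... | no  _ = #-keep us vs z≭t

      -- The first entry `x` of the longer list is cancelled against an entry of `rs` in the same
      -- branch, and the rests are compared. If `rs` has no such entry, the branch of `x` itself
      -- serves.
      pigeonhole : ∀ rs ts → length rs ℕ.< length ts → ∃ λ z → # z ∈ rs ℕ.< # z ∈ ts
      pigeonhole rs (x ∷ ts) (ℕ.s≤s rs≤ts) with Any.any? (x ≋?_) rs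
      ... | no ∄ = x , ≡.subst₂ ℕ._<_
        (≡.sym (cong length (filter-none (x ≋?_) (All.¬Any⇒All¬ rs ∄))))
        (≡.sym (#-here ts (inj₁ ∼-refl))) (ℕ.s≤s ℕ.z≤n)
      ... | yes ∃r with find ∃r
      ...   | r , r∈rs , x≋r with ∈-∃++ r∈rs
      ...     | us , vs , refl
                with pigeonhole (us ++ vs) ts (≡.subst (ℕ._≤ length ts) (length-++-sucʳ us r vs) rs≤ts)
      ...       | z , lt with z ≋? x
      ...         | yes z≋x = z , ≡.subst₂ ℕ._<_ (≡.sym (#-remove us vs (≋-trans z≋x x≋r)))
                                                (≡.sym (#-here ts z≋x)) (ℕ.s≤s lt)
      ...         | no z≭x  = z , ≡.subst₂ ℕ._<_
                    (≡.sym (#-keep us vs λ z≋r → z≭x (≋-trans z≋r (≋-sym x≋r))))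
                    (≡.sym (#-keep [] ts z≭x)) lt

      -- Lists run from the latest choice back, so `vs` holds what precedes `t`. With `n` the count
      -- of the branch in `rs`, the branch parts of `rs` and `vs` have equal length, which makes the
      -- induction possible.
      atRank : ∀ {z} n ts → n ℕ.< # z ∈ ts →
               ∃ λ t → z ≋ t × ∃₂ λ us vs → ts ≡ us ++ t ∷ vs × # z ∈ vs ≡ n
      atRank {z} n (t ∷ ts) n< with z ≋? t
      ... | no _ with atRank n ts n<
      ...   | s , z≋s , us , vs , refl , eq = s , z≋s , t ∷ us , vs , refl , eq
      atRank {z} n (t ∷ ts) n< | yes z≋t with ℕ.m≤n⇒m<n∨m≡n (ℕ.≤-pred n<)
      ... | inj₂ refl = t , z≋t , [] , ts , refl , refl
      ... | inj₁ n<′ with atRank n ts n<′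
      ...   | s , z≋s , us , vs , refl , eq = s , z≋s , t ∷ us , vs , refl , eq

      -- Unless `t` is `x` itself, `x` was still available when `t` was chosen, so over `vs` the
      -- total of `t` is at most that of `x`. Each entry from `t` on adds at least `c` to the total
      -- of `x`.
      suffix-≤ : ∀ {x t} us vs {ts} → IsGreedy B ts → B x → Apart x ts → x ∷ ts ≡ us ++ t ∷ vs →
                 tot t vs + length ts · c ≤ tot x ts + length vs · c
      suffix-≤ [] vs g Bx x≁ refl = ≤-refl
      suffix-≤ {x} {t} (_ ∷ us) vs {ts} g Bx x≁ refl with IsGreedy-suffix us g | All.++⁻ʳ us x≁
      -- The added `c` is paid for by `p x t`, which extends the suffix `vs` to `t ∷ vs`.
      ... | choice Bt _ min ∷ _ | x≁t ∷ x≁vs = +-cancelˡ-≤ c (begin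
        c + (tot t vs + length ts · c)      ≈⟨ +-assoc _ _ _ ⟨
        (c + tot t vs) + length ts · c      ≤⟨ +-monoˡ-≤ _ (+-mono-≤ (least Bx Bt x≁t) (min x Bx x≁vs)) ⟩
        tot x (t ∷ vs) + length ts · c      ≤⟨ tot-suffix us x≁ (λ i → least Bx (All.lookup (Greedy⇒All g) i) (All.lookup x≁ i)) ⟩
        tot x ts + (c + length vs · c)      ≈⟨ solve 3 (λ a b d → a ⊕ (b ⊕ d) ⊜ b ⊕ (a ⊕ d)) ≈-refl _ _ _ ⟩
        c + (tot x ts + length vs · c)      ∎)

    -- Exchange between two greedy sequences.

    private
      -- Induction on the length of `rs`. The two entries realizing the least product `c` lie in
      -- different branches, as their product is not above `c`, so every branch contains fewer
      -- entries of `rs`. Lists with fewer than two entries are settled directly.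
      exchange-acc : ∀ {B rs ts x} → Acc ℕ._<_ (length rs) → IsGreedy B rs → IsGreedy B ts →
                     length rs ℕ.≤ length ts → B x → Apart x ts →
                     ∃ λ y → B y × Apart y rs × tot y rs ≤ tot x ts
      exchange-acc {rs = []} {ts} {x} _ _ _ _ Bx x≁ = x , Bx , [] , tot-nonneg ts x≁
      exchange-acc {B} {r ∷ []} {t ∷ ts} {x} _ (choice Br _ _ ∷ []) (choice Bt _ _ ∷ _) _ Bx (x≁t ∷ x≁) =
        let y , By , y≁r , le = closer in
        y , By , y≁r ∷ [] , (begin
          p y r + 0#       ≤⟨ +-mono-≤ le (tot-nonneg ts x≁) ⟩
          p x t + tot x ts ∎)
        where
        -- If `r` is one of `x` and `t`, the other one works. Otherwise the ultrametric inequality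
        -- with `r` in the middle singles out one of them.
        closer : ∃ λ y → B y × ¬ y ∼ r × p y r ≤ p x t
        closer with x ∼? r | t ∼? r
        ... | yes x∼r | _       = t , Bt , (λ t∼r → x≁t (∼-trans x∼r (∼-sym t∼r))) , (begin
          p t r ≈⟨ p-congʳ (x≁t ∘ ∼-sym) x∼r ⟨ p t x ≈⟨ p-sym (x≁t ∘ ∼-sym) ⟩ p x t ∎)
        ... | no x≁r  | yes t∼r = x , Bx , x≁r , inj₂ (≈-sym (p-congʳ x≁t t∼r))
        ... | no x≁r  | no t≁r with p-ultrametric x≁r (t≁r ∘ ∼-sym) x≁t
        ...   | inj₁ xr≤xt = x , Bx , x≁r , xr≤xt
        ...   | inj₂ rt≤xt = t , Bt , t≁r , (begin p t r ≈⟨ p-sym t≁r ⟩ p r t ≤⟨ rt≤xt ⟩ p x t ∎)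
      exchange-acc {B} {rs@(_ ∷ _ ∷ _)} {ts} {x} (acc rec) gr gt rs≤ts Bx x≁
        with leastProduct gr
      ... | a , b , a∈ , b∈ , a≁b , least = conclusion
        where
        c = p a b
        open Branch c B least

        conclusion : ∃ λ y → B y × Apart y rs × tot y rs ≤ tot x ts
        conclusion with pigeonhole rs (x ∷ ts) (ℕ.s≤s rs≤ts)
        ... | z , lt with atRank (# z ∈ rs) (x ∷ ts) lt
        ...   | t , z≋t , us , vs , x∷ts≡ , rank with suffix-greedy us gt Bx x≁ x∷ts≡
        ...     | Bt , t≁vs , gvs with
                  exchange-acc (rec shorter) (IsGreedy-inClass z gr) (IsGreedy-inClass z gvs)
                    (ℕ.≤-reflexive (≡.sym rank)) (Bt , z≋t) (Apart-inClass⁺ vs t≁vs)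
          where
          shorter : length (inClass z rs) ℕ.< length rs
          shorter with z ≋? a
          ... | no z≭a  = filter-notAll (z ≋?_) rs (lose a∈ z≭a)
          ... | yes z≋a = filter-notAll (z ≋?_) rs (lose b∈ λ z≋b → a≭b (≋-trans (≋-sym z≋a) z≋b))
            where
            a≭b : ¬ a ≋ b
            a≭b (inj₁ a∼b)       = a≁b a∼b
            a≭b (inj₂ (_ , c<c)) = <-irrefl c<c
        ...       | y , (By , z≋y) , y≁ , y≤t = y , By , Apart-inClass⁻ rs z≋y y≁ ,
          -- The branch parts of `rs` and `vs` both have `n` entries. With `n · c + m · c` added,
          -- `tot-inClass` converts between branch totals and full totals, and `suffix-≤` passes
          -- from `t` to `x`.
          +-cancelʳ-≤ (n · c + length vs · c) (begin
            tot y rs + (n · c + m · c)                      ≈⟨ +-assoc _ _ _ ⟨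
            (tot y rs + n · c) + m · c                      ≈⟨ +-congʳ (tot-inClass rs (By , z≋y) (Greedy⇒All gr)) ⟩
            (tot y (inClass z rs) + length rs · c) + m · c  ≤⟨ +-monoˡ-≤ _ (+-mono-≤ y≤t (·-mono-≤ 0≤c rs≤ts)) ⟩
            (tot t (inClass z vs) + length ts · c) + m · c  ≈⟨ solve 3 (λ a b d → (a ⊕ b) ⊕ d ⊜ (a ⊕ d) ⊕ b) ≈-refl _ _ _ ⟩
            (tot t (inClass z vs) + m · c) + length ts · c  ≈⟨ +-congʳ (tot-inClass vs (Bt , z≋t) (Greedy⇒All gvs)) ⟨
            (tot t vs + # z ∈ vs · c) + length ts · c       ≡⟨ cong (λ k → (tot t vs + k · c) + length ts · c) rank ⟩
            (tot t vs + n · c) + length ts · c              ≈⟨ solve 3 (λ a b d → (a ⊕ b) ⊕ d ⊜ (a ⊕ d) ⊕ b) ≈-refl _ _ _ ⟩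
            (tot t vs + length ts · c) + n · c              ≤⟨ +-monoˡ-≤ _ (suffix-≤ us vs gt Bx x≁ x∷ts≡) ⟩
            (tot x ts + m · c) + n · c                      ≈⟨ solve 3 (λ a b d → (a ⊕ b) ⊕ d ⊜ a ⊕ (d ⊕ b)) ≈-refl _ _ _ ⟩
            tot x ts + (n · c + m · c)                      ∎)
          where
          n = # z ∈ rs
          m = length vs
          0≤c = p-nonneg a≁b

    exchange : ∀ {B rs ts x} → IsGreedy B rs → IsGreedy B ts → length rs ≡ length ts →
               B x → Apart x ts → ∃ λ y → B y × Apart y rs × tot y rs ≤ tot x ts
    exchange gr gt eq = exchange-acc (<-wellFounded _) gr gt (ℕ.≤-reflexive eq)

    -- Exchange in both directions: toward `rs` it yields `y` with total at most that of `x`; back,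
    -- it turns any competitor for `rs` into one for `ts`, where `x` is minimal.
    transferChoice : ∀ {B rs ts x} → IsGreedy B rs → IsGreedy B ts → length rs ≡ length ts →
                     Choice B ts x → ∃ λ y → Choice B rs y × tot y rs ≈ tot x ts
    transferChoice {B} {rs} {ts} {x} gr gt eq (choice Bx x≁ min) =
      let y , By , y≁ , y≤x = exchange gr gt eq Bx x≁ in
      y , choice By y≁ (λ w Bw w≁ → ≤-trans y≤x (below Bw w≁)) , ≤-antisym y≤x (below By y≁)
      where
      below : ∀ {w} → B w → Apart w rs → tot x ts ≤ tot w rs
      below Bw w≁ =
        let u , Bu , u≁ , u≤w = exchange gt gr (≡.sym eq) Bw w≁ in
        ≤-trans (min u Bu u≁) u≤w

    choice-unique : ∀ {B ts x y} → Choice B ts x → Choice B ts y → tot x ts ≈ tot y ts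
    choice-unique (choice Bx x≁ minx) (choice By y≁ miny) = ≤-antisym (minx _ By y≁) (miny _ Bx x≁)

-- Rooted trees and their extended boundaries

module TreeOrder {v : Level} (T : RootedTree v) where
  open RootedTree T

  infix 4 _≼_
  infixl 5 _▻_
  -- Paths grow at their far end, opposite to `Star`: a vertex has at most one incoming edge, and
  -- the inductions descend toward the root.
  data _≼_ (u : Vertex) : Vertex → Set v where
    ε   : u ≼ u
    _▻_ : ∀ {w x} → u ≼ w → w ⟶ x → u ≼ x

  ≼-trans : ∀ {u w x} → u ≼ w → w ≼ x → u ≼ x
  ≼-trans p ε       = p
  ≼-trans p (q ▻ a) = ≼-trans p q ▻ a

  fromStar : ∀ {u w} → Star _⟶_ u w → u ≼ w
  fromStar ε       = ε
  fromStar (a ◅ p) = ≼-trans (ε ▻ a) (fromStar p)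

  root≼ : ∀ x → root ≼ x
  root≼ x = fromStar (path x)

  pathEdges-◅◅ : ∀ {u w x} (p : Star _⟶_ u w) (q : Star _⟶_ w x) →
                 pathEdges (p ◅◅ q) ≡ pathEdges p ++ pathEdges q
  pathEdges-◅◅ ε       q = refl
  pathEdges-◅◅ (a ◅ p) q = cong (edge a ∷_) (pathEdges-◅◅ p q)

  edgesTo : Vertex → List Edge
  edgesTo x = pathEdges (path x)

  edgesTo-root : edgesTo root ≡ []
  edgesTo-root = cong pathEdges (uniquePath root (path root) ε)

  edgesTo-step : ∀ {u w} (a : u ⟶ w) → edgesTo w ≡ edgesTo u ++ edge a ∷ []
  edgesTo-step {u} {w} a = trans
    (cong pathEdges (uniquePath w (path w) (path u ◅◅ (a ◅ ε))))
    (pathEdges-◅◅ (path u) (a ◅ ε))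

  private
    lastEdge : List Edge → Maybe Edge
    lastEdge []           = nothing
    lastEdge (e ∷ [])     = just e
    lastEdge (_ ∷ f ∷ es) = lastEdge (f ∷ es)

    lastEdge-++ : ∀ es {e} → lastEdge (es ++ e ∷ []) ≡ just e
    lastEdge-++ []           = refl
    lastEdge-++ (_ ∷ [])     = refl
    lastEdge-++ (_ ∷ f ∷ es) = lastEdge-++ (f ∷ es)

  -- Both edges are the last edge of the unique path from the root to `w`.
  uniqueEdge : ∀ {u u′ w} (a : u ⟶ w) (b : u′ ⟶ w) → edge a ≡ edge b
  uniqueEdge {u} {u′} a b = just-injective (trans (sym (lastEdge-++ (edgesTo u)))
    (trans (cong lastEdge (trans (sym (edgesTo-step a)) (edgesTo-step b))) (lastEdge-++ (edgesTo u′))))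

  uniqueEdgeInto : ∀ e f → target e ≡ target f → e ≡ f
  uniqueEdgeInto (edge a) (edge b) refl = uniqueEdge a b

  depth : Vertex → ℕ
  depth x = length (edgesTo x)

  depth-step : ∀ {u w} → u ⟶ w → depth w ≡ suc (depth u)
  depth-step {u} a = trans (cong length (edgesTo-step a))
    (trans (length-++ (edgesTo u)) (ℕ.+-comm (depth u) 1))

  ≼⇒depth≤ : ∀ {u w} → u ≼ w → depth u ℕ.≤ depth w
  ≼⇒depth≤ ε       = ℕ.≤-refl
  ≼⇒depth≤ (p ▻ a) rewrite depth-step a = ℕ.m≤n⇒m≤1+n (≼⇒depth≤ p)

  ≼∧depth≥⇒≡ : ∀ {u w} → u ≼ w → depth w ℕ.≤ depth u → u ≡ w
  ≼∧depth≥⇒≡ ε       _ = refl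
  ≼∧depth≥⇒≡ {u} (p ▻ a) d rewrite depth-step a =
    contradiction (ℕ.≤-trans d (≼⇒depth≤ p)) (ℕ.1+n≰n)

  ≼-antisym : ∀ {u w} → u ≼ w → w ≼ u → u ≡ w
  ≼-antisym p q = ≼∧depth≥⇒≡ p (≼⇒depth≤ q)

  ≼-chain : ∀ {u w x} → u ≼ x → w ≼ x → u ≼ w ⊎ w ≼ u
  ≼-chain p       ε       = inj₁ p
  ≼-chain ε       q       = inj₂ q
  ≼-chain (p ▻ a) (q ▻ b) with uniqueEdge a b
  ... | refl = ≼-chain p q

  ≼-below : ∀ {u x} e → target e ≡ x → u ≼ x → u ≡ x ⊎ u ≼ source e
  ≼-below e        refl ε       = inj₁ refl
  ≼-below (edge b) refl (p ▻ a) with uniqueEdge a b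
  ... | refl = inj₂ p

  source≼target : ∀ e → source e ≼ target e
  source≼target (edge a) = ε ▻ a

  target⋠source : ∀ e → ¬ target e ≼ source e
  target⋠source (edge a) p = ℕ.1+n≰n (ℕ.≤-trans (ℕ.≤-reflexive (sym (depth-step a))) (≼⇒depth≤ p))

  target⋠root : ∀ e → ¬ target e ≼ root
  target⋠root e p = target⋠source e (≼-trans p (root≼ (source e)))

  edgeInto : ∀ x → x ≡ root ⊎ ∃ λ e → target e ≡ x
  edgeInto x with root≼ x
  ... | ε     = inj₁ refl
  ... | _ ▻ a = inj₂ (edge a , refl)

  first-step : ∀ {u w} → u ≼ w → u ≡ w ⊎ ∃ λ x → (u ⟶ x) × x ≼ w
  first-step ε       = inj₁ refl
  first-step (p ▻ a) with first-step p
  ... | inj₁ refl          = inj₂ (_ , a , ε)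
  ... | inj₂ (x , b , x≼w) = inj₂ (x , b , x≼w ▻ a)

  ∈-edgesTo : ∀ {x e} → e ∈ edgesTo x ⇔ target e ≼ x
  ∈-edgesTo {x} {e} = mk⇔ (to (root≼ x)) (from (root≼ x))
    where
    to : ∀ {x} → root ≼ x → e ∈ edgesTo x → target e ≼ x
    to ε e∈ with subst (e ∈_) edgesTo-root e∈
    ... | ()
    to (_▻_ {u} p a) e∈ with ∈-++⁻ (edgesTo u) (subst (e ∈_) (edgesTo-step a) e∈)
    ... | inj₁ e∈u         = to p e∈u ▻ a
    ... | inj₂ (here refl) = ε

    from : ∀ {x} → root ≼ x → target e ≼ x → e ∈ edgesTo x
    from ε e≼ = contradiction e≼ (target⋠root e)
    from (_▻_ {u} p a) e≼ = subst (e ∈_) (sym (edgesTo-step a)) (snoc (≼-below (edge a) refl e≼))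
      where
      snoc : target e ≡ _ ⊎ target e ≼ u → e ∈ edgesTo u ++ edge a ∷ []
      snoc (inj₁ t≡)  = ∈-++⁺ʳ (edgesTo u) (here (uniqueEdgeInto e (edge a) t≡))
      snoc (inj₂ e≼u) = ∈-++⁺ˡ (from p e≼u)

  edgesTo-unique : ∀ x → Unique (edgesTo x)
  edgesTo-unique x = go (root≼ x)
    where
    go : ∀ {x} → root ≼ x → Unique (edgesTo x)
    go ε = subst Unique (sym edgesTo-root) []
    go (_▻_ {u} p a) = subst Unique (sym (edgesTo-step a))
      (Unique.++⁺ (go p) ([] ∷ []) λ { (e∈u , here refl) →
        target⋠source (edge a) (Equivalence.to ∈-edgesTo e∈u) })

  -- Paths to the extended boundary as maximal chains of vertices.

  On : ∂̃ → Pred Vertex v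
  On (ray r)      u = ∃ λ n → u ≼ Ray.vertex r n
  On (leaf x _ _) u = u ≼ x

  -- Testing upper bounds suffices in `maximal`: a vertex comparable with all of `V` is either below
  -- a member, hence in `V` by `lower`, or an upper bound.
  record MaximalChain (V : Pred Vertex v) : Set v where
    field
      root∈   : V root
      lower   : ∀ {u w} → u ≼ w → V w → V u
      chain   : ∀ {u w} → V u → V w → u ≼ w ⊎ w ≼ u
      maximal : ∀ {w} → (∀ {u} → V u → u ≼ w) → V w

  module _ (r : Ray) where
    open Ray r

    ray-mono : ∀ {m n} → m ℕ.≤ n → vertex m ≼ vertex n
    ray-mono {n = n} m≤n = go (ℕ.≤⇒≤′ m≤n)
      where
      go : ∀ {m n} → m ℕ.≤′ n → vertex m ≼ vertex n
      go (ℕ.≤′-reflexive refl) = ε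
      go (ℕ.≤′-step m≤n)       = go m≤n ▻ step _

    ray-depth : ∀ n → depth (vertex n) ≡ n
    ray-depth zero    = trans (cong depth start) (cong length edgesTo-root)
    ray-depth (suc n) = trans (depth-step (step n)) (cong suc (ray-depth n))

    ray-unbounded : ∀ {w} → ¬ (∀ n → vertex n ≼ w)
    ray-unbounded {w} below = ℕ.1+n≰n
      (subst (ℕ._≤ depth w) (ray-depth (suc (depth w))) (≼⇒depth≤ (below (suc (depth w)))))

  -- A leaf other than the root has an incoming edge, and valence one would make an outgoing edge
  -- equal to it.
  leaf-childless : ∀ {x y} → IsLeaf x → ¬ x ⟶ y
  leaf-childless {x} (inj₂ (refl , all)) a = target⋠root (edge a) (subst (_≼ root) (sym (all _)) ε)
  leaf-childless {x} (inj₁ (x≢root , e , _ , only)) a with edgeInto x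
  ... | inj₁ x≡root = x≢root x≡root
  ... | inj₂ (f , refl) = target⋠source f (subst (λ g → target f ≼ source g)
    (trans (only (edge a) (inj₁ refl)) (sym (only f (inj₂ refl)))) ε)

  childless-leaf : ∀ {x} → (∀ {y} → ¬ x ⟶ y) → IsLeaf x
  childless-leaf {x} childless with edgeInto x
  ... | inj₁ refl = inj₂ (refl , λ y → case (first-step (root≼ y)))
    where
    case : ∀ {y} → root ≡ y ⊎ (∃ λ z → (root ⟶ z) × z ≼ y) → y ≡ root
    case (inj₁ root≡y)      = sym root≡y
    case (inj₂ (_ , a , _)) = contradiction a childless
  ... | inj₂ (f , refl) = inj₁
    ( (λ x≡root → target⋠root f (subst (target f ≼_) x≡root ε))
    , f , inj₂ refl
    , λ { (edge a) (inj₁ refl) → contradiction a childless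
        ; g        (inj₂ t≡)   → uniqueEdgeInto g f t≡ } )

  On-maximalChain : ∀ ρ → MaximalChain (On ρ)
  On-maximalChain (ray r) = record
    { root∈   = 0 , root≼ _
    ; lower   = λ { u≼w (n , w≼n) → n , ≼-trans u≼w w≼n }
    ; chain   = λ { (m , u≼m) (n , w≼n) → ≼-chain
                    (≼-trans u≼m (ray-mono r (ℕ.m≤m⊔n m n))) (≼-trans w≼n (ray-mono r (ℕ.m≤n⊔m m n))) }
    ; maximal = λ above → contradiction (λ n → above (n , ε)) (ray-unbounded r)
    }
  On-maximalChain (leaf x lf p) = record
    { root∈   = root≼ x
    ; lower   = ≼-trans
    ; chain   = ≼-chain
    ; maximal = λ above → childless-max (first-step (above ε))
    }
    where
    childless-max : ∀ {w} → x ≡ w ⊎ (∃ λ z → (x ⟶ z) × z ≼ w) → w ≼ x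
    childless-max (inj₁ refl)        = ε
    childless-max (inj₂ (_ , a , _)) = contradiction a (leaf-childless lf)

  -- Comparable vertices of equal depth coincide, which identifies two rays index by index. A ray
  -- and a path to a leaf cannot share all vertices, since depths along a ray are unbounded.
  On⇒≈∂ : ∀ {ρ σ} → (∀ {u} → On ρ u → On σ u) → (∀ {u} → On σ u → On ρ u) → ρ ≈∂ σ
  On⇒≈∂ {ray r} {ray s} ρ⊆σ _ = ray λ n → same n
    (MaximalChain.chain (On-maximalChain (ray s)) (ρ⊆σ (n , ε)) (n , ε))
    where
    module r = Ray r
    module s = Ray s
    d : ∀ n → depth (r.vertex n) ≡ depth (s.vertex n)
    d n = trans (ray-depth r n) (sym (ray-depth s n))
    same : ∀ n → r.vertex n ≼ s.vertex n ⊎ s.vertex n ≼ r.vertex n → r.vertex n ≡ s.vertex n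
    same n (inj₁ p) = ≼∧depth≥⇒≡ p (ℕ.≤-reflexive (sym (d n)))
    same n (inj₂ p) = sym (≼∧depth≥⇒≡ p (ℕ.≤-reflexive (d n)))
  On⇒≈∂ {ray r} {leaf _ _ _} ρ⊆σ _ = contradiction (λ n → ρ⊆σ (n , ε)) (ray-unbounded r)
  On⇒≈∂ {leaf _ _ _} {ray s} _ σ⊆ρ = contradiction (λ n → σ⊆ρ (n , ε)) (ray-unbounded s)
  On⇒≈∂ {leaf _ _ _} {leaf _ _ _} ρ⊆σ σ⊆ρ = leaf (≼-antisym (ρ⊆σ ε) (σ⊆ρ ε))

  ≈∂⇒On : ∀ {ρ σ u} → ρ ≈∂ σ → On ρ u → On σ u
  ≈∂⇒On (ray eq)    (n , u≼n) = n , subst (_ ≼_) (eq n) u≼n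
  ≈∂⇒On (leaf refl) u≼x       = u≼x

  ≈∂-sym : ∀ {ρ σ} → ρ ≈∂ σ → σ ≈∂ ρ
  ≈∂-sym (ray eq)  = ray (λ n → sym (eq n))
  ≈∂-sym (leaf eq) = leaf (sym eq)

  -- An edge is the only one into its target, so vertex sets can replace the edge sets of paths.
  E⇔On : ∀ ρ {e} → E ρ e ⇔ On ρ (target e)
  E⇔On (ray r) {e} = mk⇔ (λ { (n , refl) → suc n , ε }) (λ { (n , e≼n) → from n e≼n })
    where
    open Ray r
    from : ∀ n → target e ≼ vertex n → ∃ λ n → e ≡ edge (step n)
    from zero    e≼ = contradiction (subst (target e ≼_) start e≼) (target⋠root e)
    from (suc n) e≼ with ≼-below (edge (step n)) refl e≼
    ... | inj₁ t≡  = n , uniqueEdgeInto e (edge (step n)) t≡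
    ... | inj₂ e≼n = from n e≼n
  E⇔On (leaf x _ p) {e} = subst (λ q → e ∈ pathEdges q ⇔ target e ≼ x) (uniquePath x (path x) p) ∈-edgesTo

  IsMeet : ∂̃ → ∂̃ → Vertex → Set v
  IsMeet ρ σ m = On ρ m × On σ m × (∀ {u} → On ρ u → On σ u → u ≼ m)

  module _ (em : ExcludedMiddle v) where

    byContradiction : {A : Set v} → ¬ ¬ A → A
    byContradiction = decidable-stable em

    -- A vertex of `σ` outside `ρ` would lie above all of `ρ`, since `σ` is a chain, and maximality
    -- would put it on `ρ`.
    On⊆⇒≈∂ : ∀ {ρ σ} → (∀ {u} → On ρ u → On σ u) → ρ ≈∂ σ
    On⊆⇒≈∂ {ρ} {σ} ρ⊆σ = On⇒≈∂ ρ⊆σ λ {u} σu → byContradiction λ ¬ρu →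
      ¬ρu (ρ.maximal λ ρw → below ¬ρu ρw (σ.chain (ρ⊆σ ρw) σu))
      where
      module ρ = MaximalChain (On-maximalChain ρ)
      module σ = MaximalChain (On-maximalChain σ)
      below : ∀ {u w} → ¬ On ρ u → On ρ w → w ≼ u ⊎ u ≼ w → w ≼ u
      below ¬ρu ρw (inj₁ w≼u) = w≼u
      below ¬ρu ρw (inj₂ u≼w) = contradiction (ρ.lower u≼w ρw) ¬ρu

    -- From a vertex on `ρ` but not on `σ`, descend toward the root until the predecessor lies on
    -- `σ` as well; the paths part there.
    ∃-meet : ∀ {ρ σ} → ¬ ρ ≈∂ σ → ∃ (IsMeet ρ σ)
    ∃-meet {ρ} {σ} ρ≉σ with em {∃ λ u → On ρ u × ¬ On σ u}
    ... | no ∄ = contradiction (On⊆⇒≈∂ λ ρu → byContradiction λ ¬σu → ∄ (_ , ρu , ¬σu)) ρ≉σ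
    ... | yes (u , ρu , ¬σu) = go (root≼ u) ρu ¬σu
      where
      module ρ = MaximalChain (On-maximalChain ρ)
      module σ = MaximalChain (On-maximalChain σ)
      go : ∀ {u} → root ≼ u → On ρ u → ¬ On σ u → ∃ (IsMeet ρ σ)
      go ε ρu ¬σu = contradiction σ.root∈ ¬σu
      go {u} (_▻_ {w} p a) ρu ¬σu with em {On σ w}
      ... | no ¬σw = go p (ρ.lower (ε ▻ a) ρu) ¬σw
      ... | yes σw = w , ρ.lower (ε ▻ a) ρu , σw , greatest
        where
        greatest : ∀ {x} → On ρ x → On σ x → x ≼ w
        greatest ρx σx with ρ.chain ρx ρu
        ... | inj₂ u≼x = contradiction (σ.lower u≼x σx) ¬σu
        ... | inj₁ x≼u with ≼-below (edge a) refl x≼u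
        ...   | inj₁ refl = contradiction σx ¬σu
        ...   | inj₂ x≼w  = x≼w

    -- Any maximal chain is the vertex set of a path: without a last vertex it
    -- is followed forever by choosing successors.
    ∃-path : ∀ {V} → MaximalChain V → ∃ λ ρ → ∀ {u} → On ρ u ⇔ V u
    ∃-path {V} V-max with em {∃ λ u → V u × (∀ {w} → u ⟶ w → ¬ V w)}
    ... | yes (x , Vx , last) = leaf x (childless-leaf childless) (path x) , mk⇔ (λ u≼x → lower u≼x Vx) below
      where
      open MaximalChain V-max
      below : ∀ {u} → V u → u ≼ x
      below Vu with chain Vu Vx
      ... | inj₁ u≼x = u≼x
      ... | inj₂ x≼u with first-step x≼u
      ...   | inj₁ refl            = ε
      ...   | inj₂ (w , a , w≼u) = contradiction (lower w≼u Vu) (last a)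
      childless : ∀ {y} → ¬ x ⟶ y
      childless a = last a (maximal λ Vu → below Vu ▻ a)
    ... | no ∄last = ray r , mk⇔ (λ { (n , u≼n) → lower u≼n (proj₂ (seq n)) }) onRay
      where
      open MaximalChain V-max
      next : (w : ∃ V) → ∃ λ (x : ∃ V) → proj₁ w ⟶ proj₁ x
      next (u , Vu) = byContradiction λ ∄next → ∄last (u , Vu , λ a Vw → ∄next ((_ , Vw) , a))
      seq : ℕ → ∃ V
      seq zero    = root , root∈
      seq (suc n) = proj₁ (next (seq n))
      r : Ray
      r = record { vertex = proj₁ ∘ seq ; start = refl ; step = λ n → proj₂ (next (seq n)) }
      onRay : ∀ {u} → V u → ∃ λ n → u ≼ proj₁ (seq n)
      -- A member of the chain below no `seq n` would lie above all of them, against the unbounded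
      -- depths.
      onRay Vu = byContradiction λ ∄n → ray-unbounded r λ n → comparable (∄n ∘ (n ,_)) (chain Vu (proj₂ (seq n)))
        where
        comparable : ∀ {u w} → ¬ u ≼ w → u ≼ w ⊎ w ≼ u → w ≼ u
        comparable u⋠w (inj₁ u≼w) = contradiction u≼w u⋠w
        comparable _   (inj₂ w≼u) = w≼u

-- The path metric of the realization

module RealizationMetric (ℝ : CompleteOrderedField) {v : Level} (em : ExcludedMiddle v)
                         (T : LengthTree ℝ v) where
  open OrderedField ℝ
  open ≤-Reasoning
  open LengthTree T
  open TreeOrder tree
  open Realization ℝ T
  open Setoid Γ using () renaming (refl to ≃-refl; sym to ≃-sym; trans to ≃-trans)

  glue : ∀ {x y} → Glue x y → x ≃ y
  glue = EqClosure.return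

  sumℓ : List Edge → Carrier
  sumℓ es = foldr _+_ 0# (map ℓ es)

  sumℓ-snoc : ∀ es e → sumℓ (es ++ e ∷ []) ≈ sumℓ es + ℓ e
  sumℓ-snoc []       e = +-comm (ℓ e) 0#
  sumℓ-snoc (f ∷ es) e = ≈-trans (+-congˡ (sumℓ-snoc es e)) (≈-sym (+-assoc _ _ _))

  height : Vertex → Carrier
  height u = sumℓ (edgesTo u)

  height-step : ∀ e → height (target e) ≈ height (source e) + ℓ e
  height-step e@(edge a) = begin-equality
    sumℓ (edgesTo (target e))          ≡⟨ cong sumℓ (edgesTo-step a) ⟩
    sumℓ (edgesTo (source e) ++ e ∷ []) ≈⟨ sumℓ-snoc (edgesTo (source e)) e ⟩
    height (source e) + ℓ e            ∎

  height-root : height root ≈ 0#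
  height-root = begin-equality height root ≡⟨ cong sumℓ edgesTo-root ⟩ 0# ∎

  height-mono : ∀ {u w} → u ≼ w → height u ≤ height w
  height-mono ε       = ≤-refl
  height-mono (_▻_ {w} {x} p a) = begin
    height _             ≤⟨ height-mono p ⟩
    height w             ≤⟨ x≤x+y _ (inj₁ (ℓ>0 (edge a))) ⟩
    height w + ℓ (edge a) ≈⟨ height-step (edge a) ⟨
    height x             ∎

  ceiling : Edge → Carrier → Vertex
  ceiling e t with compare t 0#
  ... | tri< _ _ _ = target e
  ... | tri≈ _ _ _ = source e
  ... | tri> _ _ _ = target e

  -- The first vertex at or beyond a point.
  top : Point → Vertex
  top (vertex u)       = u
  top (onEdge e t _ _) = ceiling e t

  h : Point → Carrier
  h (vertex u)       = height u
  h (onEdge e t _ _) = height (source e) + t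

  -- A function compatible with the gluing and 1-Lipschitz along each edge. Differences of its
  -- values bound path lengths, and hence distances, from below.
  record Potential : Set v where
    field
      F      : Vertex → Carrier
      G      : Edge → Carrier → Carrier
      G-cong : ∀ e {s t} → s ≈ t → G e s ≈ G e t
      G-0    : ∀ e → G e 0# ≈ F (source e)
      G-ℓ    : ∀ e → G e (ℓ e) ≈ F (target e)
      G-lip  : ∀ e s t → G e t ≤ G e s + ∣ s - t ∣

    value : Point → Carrier
    value (vertex u)       = F u
    value (onEdge e t _ _) = G e t

    value-≃ : ∀ {x y} → x ≃ y → value x ≈ value y
    value-≃ = EqClosure.gfold ≈-isEquivalence value λ where
      (atSource t≈0)       → ≈-trans (G-cong _ t≈0) (G-0 _)
      (atTarget t≈ℓ)       → ≈-trans (G-cong _ t≈ℓ) (G-ℓ _)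
      (sameCoordinate s≈t) → G-cong _ s≈t

    value-path : ∀ {x y c} → PolygonalPath x y c → value y ≤ value x + c
    value-path {x} {y} (done x≃y) = begin
      value y      ≈⟨ value-≃ x≃y ⟨
      value x      ≈⟨ +-identityʳ _ ⟨
      value x + 0# ∎
    value-path {x} {y} (move {d = d} e {s} {t} x≃s path) = begin
      value y                        ≤⟨ value-path path ⟩
      G e t + d                      ≤⟨ +-monoˡ-≤ d (G-lip e s t) ⟩
      (G e s + ∣ s - t ∣) + d        ≈⟨ +-assoc _ _ _ ⟩
      G e s + (∣ s - t ∣ + d)        ≈⟨ +-congʳ (value-≃ x≃s) ⟨
      value x + (∣ s - t ∣ + d)      ∎

    value-distance : ∀ {x y d} → IsDistance x y d → value y ≤ value x + d
    value-distance {x} {y} {d} dist = begin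
      value y                       ≈⟨ x+[y-x]≈y (value x) (value y) ⟨
      value x + (value y - value x) ≤⟨ +-monoʳ-≤ (value x) (IsDistance.greatest dist _ λ c path →
        +-cancelˡ-≤ (value x) (begin
          value x + (value y - value x) ≈⟨ x+[y-x]≈y (value x) (value y) ⟩
          value y                       ≤⟨ value-path path ⟩
          value x + c                   ∎)) ⟩
      value x + d                   ∎

  heightPotential : Potential
  heightPotential = record
    { F      = height
    ; G      = λ e t → height (source e) + t
    ; G-cong = λ _ → +-congˡ
    ; G-0    = λ _ → +-identityʳ _
    ; G-ℓ    = λ e → ≈-sym (height-step e)
    ; G-lip  = λ e s t → ≤-trans (+-monoʳ-≤ _ (y≤x+∣x-y∣ s t)) (inj₂ (≈-sym (+-assoc _ _ _)))
    }

  private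
    module H = Potential heightPotential

    value-h : ∀ x → H.value x ≡ h x
    value-h (vertex _)       = refl
    value-h (onEdge _ _ _ _) = refl

  h-≃ : ∀ {x y} → x ≃ y → h x ≈ h y
  h-≃ {x} {y} x≃y = ≡.subst₂ _≈_ (value-h x) (value-h y) (H.value-≃ x≃y)

  h-path : ∀ {x y c} → PolygonalPath x y c → h y ≤ h x + c
  h-path {x} {y} {c} p = ≡.subst₂ (λ a b → a ≤ b + c) (value-h y) (value-h x) (H.value-path p)

  ceiling-0 : ∀ {e t} → t ≈ 0# → ceiling e t ≡ source e
  ceiling-0 {t = t} t≈0 with compare t 0#
  ... | tri< _ t≉0 _ = contradiction t≈0 t≉0
  ... | tri≈ _ _ _   = refl
  ... | tri> _ t≉0 _ = contradiction t≈0 t≉0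

  ceiling-> : ∀ {e t} → 0# < t → ceiling e t ≡ target e
  ceiling-> {t = t} 0<t with compare t 0#
  ... | tri< _ _ _   = refl
  ... | tri≈ _ _ 0≮t = contradiction 0<t 0≮t
  ... | tri> _ _ _   = refl

  top-≃ : ∀ {x y} → x ≃ y → top x ≡ top y
  top-≃ = EqClosure.gfold ≡.isEquivalence top λ where
    (atSource t≈0)                     → ceiling-0 t≈0
    (atTarget {e} t≈ℓ)                 → ceiling-> (<-respʳ-≈ (≈-sym t≈ℓ) (ℓ>0 e))
    (sameCoordinate {p = inj₁ 0<s} s≈t) → trans (ceiling-> 0<s) (sym (ceiling-> (<-respʳ-≈ s≈t 0<s)))
    (sameCoordinate {p = inj₂ 0≈s} s≈t) → trans (ceiling-0 (≈-sym 0≈s)) (sym (ceiling-0 (≈-trans (≈-sym s≈t) (≈-sym 0≈s))))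

  -- Each edge keeps its half-open interval without the source: a vertex other than the root is
  -- placed at the end of its incoming edge.
  data NormalForm (x : Point) : Set v where
    atRoot : x ≃ vertex root → NormalForm x
    inEdge : ∀ e t p q → x ≃ onEdge e t p q → 0# < t → NormalForm x

  normalForm : ∀ x → NormalForm x
  normalForm (vertex u) with edgeInto u
  ... | inj₁ refl       = atRoot ≃-refl
  ... | inj₂ (e , refl) = inEdge e (ℓ e) (inj₁ (ℓ>0 e)) ≤-refl (≃-sym (glue (atTarget ≈-refl))) (ℓ>0 e)
  normalForm (onEdge e t p@(inj₁ 0<t) q) = inEdge e t p q ≃-refl 0<t
  normalForm (onEdge e t (inj₂ 0≈t) q) with normalForm (vertex (source e))
  ... | atRoot eq             = atRoot (≃-trans (glue (atSource (≈-sym 0≈t))) eq)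
  ... | inEdge f s p q eq 0<s = inEdge f s p q (≃-trans (glue (atSource (≈-sym 0≈t))) eq) 0<s

  -- The order on the points of the realization.

  infix 4 _⊑_
  -- This encodes that `x` lies between the root and `y`. Heights decide only between points with
  -- the same `top`, as `⊑-strict` shows.
  record _⊑_ (x y : Point) : Set v where
    constructor below
    field
      top≼ : top x ≼ top y
      h≤   : h x ≤ h y

  ⊑-trans : ∀ {x y z} → x ⊑ y → y ⊑ z → x ⊑ z
  ⊑-trans (below p le) (below q le′) = below (≼-trans p q) (≤-trans le le′)

  ⊑-reflexive : ∀ {x y} → x ≃ y → x ⊑ y
  ⊑-reflexive {x} x≃y = below (subst (top x ≼_) (top-≃ x≃y) ε) (inj₂ (h-≃ x≃y))

  h≤height-top : ∀ x → h x ≤ height (top x)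
  h≤height-top (vertex u) = ≤-refl
  h≤height-top (onEdge e t (inj₁ 0<t) q) = begin
    height (source e) + t              ≤⟨ +-monoʳ-≤ _ q ⟩
    height (source e) + ℓ e            ≈⟨ height-step e ⟨
    height (target e)                  ≡⟨ cong height (ceiling-> 0<t) ⟨
    height (top (onEdge e t (inj₁ 0<t) q)) ∎
  h≤height-top (onEdge e t (inj₂ 0≈t) q) = begin
    height (source e) + t              ≈⟨ +-congˡ 0≈t ⟨
    height (source e) + 0#             ≈⟨ +-identityʳ _ ⟩
    height (source e)                  ≡⟨ cong height (ceiling-0 (≈-sym 0≈t)) ⟨
    height (top (onEdge e t (inj₂ 0≈t) q)) ∎

  ⊑-top : ∀ x → x ⊑ vertex (top x)
  ⊑-top x = below ε (h≤height-top x)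

  -- Here `u` is at or before the source of the edge that contains `y`, and `y` lies strictly beyond
  -- that source.
  height<h : ∀ {u y} → u ≼ top y → u ≢ top y → height u < h y
  height<h {u} {y} u≼y u≢y with normalForm y
  ... | atRoot eq = contradiction
    (≼-antisym u≼y (subst (_≼ u) (sym (top-≃ eq)) (root≼ u))) u≢y
  ... | inEdge e t p q eq 0<t with ≼-below e (sym (trans (top-≃ eq) (ceiling-> 0<t))) u≼y
  ...   | inj₁ u≡y = contradiction u≡y u≢y
  ...   | inj₂ u≼e = begin-strict
    height u              ≤⟨ height-mono u≼e ⟩
    height (source e)     <⟨ x<x+y _ 0<t ⟩
    height (source e) + t ≈⟨ h-≃ eq ⟨
    h y                   ∎

  ⊑-strict : ∀ {x y} → top x ≼ top y → top x ≢ top y → x ⊑ y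
  ⊑-strict {x} {y} p ne = below p (≤-trans (h≤height-top x) (inj₁ (height<h {y = y} p ne)))

  ⊑-connex : ∀ {x y} → top x ≼ top y ⊎ top y ≼ top x → x ⊑ y ⊎ y ⊑ x
  ⊑-connex {x} {y} comparable with em {top x ≡ top y} | comparable
  ... | no ne | inj₁ p = inj₁ (⊑-strict p ne)
  ... | no ne | inj₂ p = inj₂ (⊑-strict p (ne ∘ sym))
  ... | yes eq | _ with ≤-total (h x) (h y)
  ...   | inj₁ le = inj₁ (below (subst (top x ≼_) eq ε) le)
  ...   | inj₂ ge = inj₂ (below (subst (_≼ top x) eq ε) ge)

  -- Ascending paths and distances.

  path-≃ˡ : ∀ {x y z c} → x ≃ y → PolygonalPath y z c → PolygonalPath x z c
  path-≃ˡ x≃y (done y≃z)   = done (≃-trans x≃y y≃z)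
  path-≃ˡ x≃y (move e s p) = move e (≃-trans x≃y s) p

  -- By `h-path` no path from `x` to `y` is shorter than the difference of heights, so a climb is a
  -- shortest path.
  Climb : Point → Point → Set v
  Climb x y = ∃ λ c → PolygonalPath x y c × h x + c ≈ h y

  climb-≃ : ∀ {x y} → x ≃ y → Climb x y
  climb-≃ x≃y = 0# , done x≃y , ≈-trans (+-identityʳ _) (h-≃ x≃y)

  climb-trans : ∀ {x y z} → Climb x y → Climb y z → Climb x z
  climb-trans {x} {y} {z} (c , p , xc≈y) (d , q , yd≈z) with append p q
    where
    append : ∀ {x y z c d} → PolygonalPath x y c → PolygonalPath y z d →
             ∃ λ b → PolygonalPath x z b × b ≈ c + d
    append {d = d} (done x≃y) q = d , path-≃ˡ x≃y q , ≈-sym (+-identityˡ d)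
    append (move e s p) q with append p q
    ... | b , r , b≈ = _ , move e s r , ≈-trans (+-congˡ b≈) (≈-sym (+-assoc _ _ _))
  ... | b , r , b≈ = b , r , (begin-equality
    h x + b       ≈⟨ +-congˡ b≈ ⟩
    h x + (c + d) ≈⟨ +-assoc _ _ _ ⟨
    (h x + c) + d ≈⟨ +-congʳ xc≈y ⟩
    h y + d       ≈⟨ yd≈z ⟩
    h z           ∎)

  climb-segment : ∀ {x y e s t p q p′ q′} → x ≃ onEdge e s p q → onEdge e t p′ q′ ≃ y → s ≤ t → Climb x y
  climb-segment {x} {y} {e} {s} {t} x≃s t≃y s≤t = _ , move e x≃s (done t≃y) , (begin-equality
    h x + (∣ s - t ∣ + 0#)                   ≈⟨ +-cong (h-≃ x≃s) (+-identityʳ _) ⟩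
    (height (source e) + s) + ∣ s - t ∣      ≈⟨ +-assoc _ _ _ ⟩
    height (source e) + (s + ∣ s - t ∣)      ≈⟨ +-congˡ (x≤y⇒x+∣x-y∣≈y s≤t) ⟩
    height (source e) + t                    ≈⟨ h-≃ t≃y ⟩
    h y                                      ∎)

  climb-fromSource : ∀ {y e t p q} → onEdge e t p q ≃ y → Climb (vertex (source e)) y
  climb-fromSource {e = e} {p = p} = λ t≃y →
    climb-segment {p = ≤-refl} {q = inj₁ (ℓ>0 e)} (≃-sym (glue (atSource ≈-refl))) t≃y p

  climb-toTarget : ∀ {x e t p q} → x ≃ onEdge e t p q → Climb x (vertex (target e))
  climb-toTarget {e = e} {q = q} x≃t =
    climb-segment {p′ = inj₁ (ℓ>0 e)} {q′ = ≤-refl} x≃t (glue (atTarget ≈-refl)) q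

  climb-vertex : ∀ {u w} → u ≼ w → Climb (vertex u) (vertex w)
  climb-vertex ε       = climb-≃ ≃-refl
  climb-vertex (p ▻ a) = climb-trans (climb-vertex p)
    (climb-fromSource {e = edge a} {p = inj₁ (ℓ>0 (edge a))} {q = ≤-refl} (glue (atTarget ≈-refl)))

  -- Between different edges the path rises to the target of the first, follows the tree to the
  -- source of the second, and rises to `y`. Within one edge a single segment suffices.
  climb : ∀ {x y} → x ⊑ y → Climb x y
  climb {x} {y} (below x≼y hx≤hy) with normalForm x | normalForm y
  ... | atRoot x≃r | atRoot y≃r = climb-≃ (≃-trans x≃r (≃-sym y≃r))
  ... | atRoot x≃r | inEdge f t p q y≃t 0<t =
    climb-trans (climb-≃ x≃r) (climb-trans (climb-vertex (root≼ (source f))) (climb-fromSource (≃-sym y≃t)))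
  ... | inEdge e s p q x≃s 0<s | atRoot y≃r = contradiction
    (≡.subst₂ _≼_ (trans (top-≃ x≃s) (ceiling-> 0<s)) (top-≃ y≃r) x≼y) (target⋠root e)
  ... | inEdge e s p q x≃s 0<s | inEdge f t p′ q′ y≃t 0<t
      with ≼-below f refl (≡.subst₂ _≼_ (trans (top-≃ x≃s) (ceiling-> 0<s)) (trans (top-≃ y≃t) (ceiling-> 0<t)) x≼y)
  ...   | inj₂ e≼f = climb-trans (climb-toTarget x≃s)
                       (climb-trans (climb-vertex e≼f) (climb-fromSource (≃-sym y≃t)))
  ...   | inj₁ e≡f with uniqueEdgeInto e f e≡f
  ...     | refl = climb-segment x≃s (≃-sym y≃t) (+-cancelˡ-≤ (height (source e)) (begin
    height (source e) + s ≈⟨ h-≃ x≃s ⟨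
    h x                   ≤⟨ hx≤hy ⟩
    h y                   ≈⟨ h-≃ y≃t ⟩
    height (source e) + t ∎))

  ⊑⇒distance : ∀ {x y d} → x ⊑ y → h x + d ≈ h y → IsDistance x y d
  ⊑⇒distance {x} {y} {d} x⊑y xd≈y with climb x⊑y
  ... | c , p , xc≈y = record
    { lowerBound = λ b q → +-cancelˡ-≤ (h x) (≤-trans (inj₂ xd≈y) (h-path q))
    ; greatest   = λ b below → ≤-trans (below c p)
        (+-cancelˡ-≤ (h x) (inj₂ (≈-trans xc≈y (≈-sym xd≈y))))
    }

  path-nonneg : ∀ {x y c} → PolygonalPath x y c → 0# ≤ c
  path-nonneg (done _)             = ≤-refl
  path-nonneg (move e {s} {t} _ p) = ≤-trans (0≤∣x∣ (s - t)) (x≤x+y _ (path-nonneg p))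

  distance-nonneg : ∀ {x y d} → IsDistance x y d → 0# ≤ d
  distance-nonneg dist = IsDistance.greatest dist 0# (λ _ → path-nonneg)

  distance-≃ˡ : ∀ {x y z d} → x ≃ y → IsDistance x z d → IsDistance y z d
  distance-≃ˡ x≃y dist = record
    { lowerBound = λ c p → IsDistance.lowerBound dist c (path-≃ˡ x≃y p)
    ; greatest   = λ b below → IsDistance.greatest dist b (λ c p → below c (path-≃ˡ (≃-sym x≃y) p))
    }

  root⊑ : ∀ y → vertex root ⊑ y
  root⊑ y with climb-root
    where
    climb-root : Climb (vertex root) y
    climb-root with normalForm y
    ... | atRoot y≃r             = climb-≃ (≃-sym y≃r)
    ... | inEdge e t p q y≃t 0<t = climb-trans (climb-vertex (root≼ (source e))) (climb-fromSource (≃-sym y≃t))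
  ... | c , p , eq = below (root≼ (top y)) (≤-trans (x≤x+y _ (path-nonneg p)) (inj₂ eq))

  distance-root : ∀ {y d} → IsDistance (vertex root) y d → d ≈ h y
  distance-root {y} {d} dist with climb (root⊑ y)
  ... | c , p , rc≈y = ≤-antisym
    (begin
      d               ≤⟨ IsDistance.lowerBound dist c p ⟩
      c               ≈⟨ +-identityˡ c ⟨
      0# + c          ≈⟨ +-congʳ height-root ⟨
      height root + c ≈⟨ rc≈y ⟩
      h y             ∎)
    (IsDistance.greatest dist (h y) λ b q → begin
      h y             ≤⟨ h-path q ⟩
      height root + b ≈⟨ +-congʳ height-root ⟩
      0# + b          ≈⟨ +-identityˡ b ⟩
      b               ∎)

  -- The distance to the point at distance s from the source of f, shifted by
  -- its height, except that outside f and the branch beyond f the distance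
  -- from source f is replaced by the difference of heights.
  module Detour (f : Edge) (s : Carrier) (0<s : 0# < s) (s≤ℓ : s ≤ ℓ f) where
    -- A path from the point at distance `s` that leaves `f` through its source first descends by
    -- `s`, so it exceeds the difference of heights by at least twice `s`.
    excess : Vertex → Carrier
    excess u with em {target f ≼ u}
    ... | yes _ = 0#
    ... | no  _ = s + s

    excess-beyond : ∀ {u} → target f ≼ u → excess u ≈ 0#
    excess-beyond {u} f≼u with em {target f ≼ u}
    ... | yes _  = ≈-refl
    ... | no f⋠u = contradiction f≼u f⋠u

    excess-outside : ∀ {u} → ¬ target f ≼ u → excess u ≈ s + s
    excess-outside {u} f⋠u with em {target f ≼ u}
    ... | yes f≼u = contradiction f≼u f⋠u
    ... | no _    = ≈-refl

    F : Vertex → Carrier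
    F u = height u + excess u

    G : Edge → Carrier → Carrier
    G e t with em {e ≡ f}
    ... | yes _ = height (source e) + (s + ∣ s - t ∣)
    ... | no  _ = F (source e) + t

    -- The branch beyond `f` is entered only through `f`, so any other edge has both ends in it or
    -- both outside.
    excess-step : ∀ {e} → e ≢ f → excess (source e) ≈ excess (target e)
    excess-step {e} e≢f with em {target f ≼ source e}
    ... | yes f≼e = ≈-sym (excess-beyond (≼-trans f≼e (source≼target e)))
    ... | no f⋠e  = ≈-sym (excess-outside λ f≼e → beyond (≼-below e refl f≼e))
      where
      beyond : ¬ (target f ≡ target e ⊎ target f ≼ source e)
      beyond (inj₁ f≡e) = e≢f (sym (uniqueEdgeInto f e f≡e))
      beyond (inj₂ f≼e) = f⋠e f≼e

    potential : Potential
    potential = record { F = F ; G = G ; G-cong = G-cong ; G-0 = G-0 ; G-ℓ = G-ℓ ; G-lip = G-lip }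
      where
      G-cong : ∀ e {t u} → t ≈ u → G e t ≈ G e u
      G-cong e t≈u with em {e ≡ f}
      ... | yes _ = +-congˡ (+-congˡ (∣x-y∣-congʳ t≈u))
      ... | no  _ = +-congˡ t≈u

      G-0 : ∀ e → G e 0# ≈ F (source e)
      G-0 e with em {e ≡ f}
      ... | yes refl = +-congˡ (≈-trans (+-congˡ (∣x-0∣≈x (inj₁ 0<s))) (≈-sym (excess-outside (target⋠source f))))
      ... | no  _    = +-identityʳ _

      G-ℓ : ∀ e → G e (ℓ e) ≈ F (target e)
      G-ℓ e with em {e ≡ f}
      ... | yes refl = begin-equality
        height (source f) + (s + ∣ s - ℓ f ∣) ≈⟨ +-congˡ (x≤y⇒x+∣x-y∣≈y s≤ℓ) ⟩
        height (source f) + ℓ f               ≈⟨ height-step f ⟨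
        height (target f)                     ≈⟨ +-identityʳ _ ⟨
        height (target f) + 0#                ≈⟨ +-congˡ (excess-beyond ε) ⟨
        F (target f)                          ∎
      ... | no e≢f = begin-equality
        (height (source e) + excess (source e)) + ℓ e ≈⟨ +-congʳ (+-congˡ (excess-step e≢f)) ⟩
        (height (source e) + excess (target e)) + ℓ e ≈⟨ solve 3 (λ a b c → (a ⊕ b) ⊕ c ⊜ (a ⊕ c) ⊕ b) ≈-refl _ _ _ ⟩
        (height (source e) + ℓ e) + excess (target e) ≈⟨ +-congʳ (height-step e) ⟨
        F (target e)                                  ∎

      G-lip : ∀ e t u → G e u ≤ G e t + ∣ t - u ∣
      G-lip e t u with em {e ≡ f}
      ... | yes _ = begin
        height (source e) + (s + ∣ s - u ∣)                 ≤⟨ +-monoʳ-≤ _ (+-monoʳ-≤ s (∣x-y∣-triangle s t u)) ⟩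
        height (source e) + (s + (∣ s - t ∣ + ∣ t - u ∣))   ≈⟨ solve 4 (λ a b c d → a ⊕ (b ⊕ (c ⊕ d)) ⊜ (a ⊕ (b ⊕ c)) ⊕ d) ≈-refl _ _ _ _ ⟩
        (height (source e) + (s + ∣ s - t ∣)) + ∣ t - u ∣   ∎
      ... | no _ = begin
        F (source e) + u                   ≤⟨ +-monoʳ-≤ _ (y≤x+∣x-y∣ t u) ⟩
        F (source e) + (t + ∣ t - u ∣)     ≈⟨ +-assoc _ _ _ ⟨
        (F (source e) + t) + ∣ t - u ∣     ∎

    open Potential potential using (value; value-≃; value-distance) public

    0<s+s : 0# < s + s
    0<s+s = begin-strict 0# <⟨ 0<s ⟩ s <⟨ x<x+y s 0<s ⟩ s + s ∎

    value-outside : ∀ y → ¬ target f ≼ top y → h y < value y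
    value-outside (vertex u) f⋠y = begin-strict
      height u             <⟨ x<x+y _ 0<s+s ⟩
      height u + (s + s)   ≈⟨ +-congˡ (excess-outside f⋠y) ⟨
      F u                  ∎
    value-outside y@(onEdge e t (inj₂ 0≈t) q) f⋠y = begin-strict
      h y             ≈⟨ h-≃ y≃source ⟩
      height (source e) <⟨ value-outside (vertex (source e)) (subst (λ u → ¬ target f ≼ u) (top-≃ y≃source) f⋠y) ⟩
      F (source e)    ≈⟨ value-≃ y≃source ⟨
      value y         ∎
      where
      y≃source : y ≃ vertex (source e)
      y≃source = glue (atSource (≈-sym 0≈t))
    value-outside (onEdge e t (inj₁ 0<t) q) f⋠y with em {e ≡ f}
    ... | yes refl = contradiction (subst (target f ≼_) (sym (ceiling-> 0<t)) ε) f⋠y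
    ... | no e≢f   = begin-strict
      height (source e) + t             <⟨ +-monoˡ-< _ _ t (x<x+y _ 0<s+s) ⟩
      (height (source e) + (s + s)) + t ≈⟨ +-congʳ (+-congˡ (excess-outside λ f≼e →
        f⋠y (subst (target f ≼_) (sym (ceiling-> 0<t)) (≼-trans f≼e (source≼target e))))) ⟨
      F (source e) + t                  ∎

    value-centre : G f s ≈ height (source f) + s
    value-centre with em {f ≡ f}
    ... | no f≢f = contradiction refl f≢f
    ... | yes _  = +-congˡ (x≤y⇒x+∣x-y∣≈y ≤-refl)

  -- If `top x` were not below `top y`, then `x` would not be the root, and the `Detour` potential
  -- centred at `x` would equal the height at `x` but exceed it at `y`. The distance would then
  -- exceed the difference of heights.
  distance⇒⊑ : ∀ {x y d} → IsDistance x y d → h x + d ≈ h y → x ⊑ y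
  distance⇒⊑ {x} {y} {d} dist xd≈y = below top≼ (≤-trans (x≤x+y _ (distance-nonneg dist)) (inj₂ xd≈y))
    where
    top≼ : top x ≼ top y
    top≼ with em {top x ≼ top y} | normalForm x
    ... | yes x≼y | _          = x≼y
    ... | no _    | atRoot x≃r = subst (_≼ top y) (sym (top-≃ x≃r)) (root≼ (top y))
    ... | no x⋠y  | inEdge f s p q x≃s 0<s = contradiction (begin-strict
      h y                 <⟨ value-outside y (subst (λ u → ¬ u ≼ top y) (trans (top-≃ x≃s) (ceiling-> 0<s)) x⋠y) ⟩
      value y             ≤⟨ value-distance dist ⟩
      value x + d         ≈⟨ +-congʳ (value-≃ x≃s) ⟩
      G f s + d           ≈⟨ +-congʳ value-centre ⟩
      (height (source f) + s) + d ≈⟨ +-congʳ (h-≃ x≃s) ⟨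
      h x + d             ≈⟨ xd≈y ⟩
      h y                 ∎) <-irrefl
      where open Detour f s 0<s q

-- Comparison of two trees

open Equivalence using (to; from)

-- The product on the extended boundary.

module ExtendedBoundary (ℝ : CompleteOrderedField) {v : Level} (em : ExcludedMiddle v)
                        (T : LengthTree ℝ v) where
  open OrderedField ℝ
  open LengthTree T
  open TreeOrder tree
  open RealizationMetric ℝ em T
  open Greedy ℝ em T

  sumℓ-↭ : ∀ {es fs} → es ↭ fs → sumℓ es ≈ sumℓ fs
  sumℓ-↭ ↭.refl         = ≈-refl
  sumℓ-↭ (prep e p)     = +-congˡ (sumℓ-↭ p)
  sumℓ-↭ (swap e f p)   = ≈-trans (solve 3 (λ a b c → a ⊕ (b ⊕ c) ⊜ b ⊕ (a ⊕ c)) ≈-refl _ _ _)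
                                  (+-congˡ (+-congˡ (sumℓ-↭ p)))
  sumℓ-↭ (↭.trans p q)  = ≈-trans (sumℓ-↭ p) (sumℓ-↭ q)

  -- Excluded middle supplies an unspecified enumeration. Two enumerations of one set without
  -- repetitions are permutations of each other, so the sum does not depend on it.
  ∑ℓ-enumerated : ∀ {P es} → Enumerates es P → ∑ℓ P ≈ sumℓ es
  ∑ℓ-enumerated {P} {es} (unique , es⇔P) = go em
    where
    go : (d : Dec (∃ λ fs → Enumerates fs P)) → sumOver d ≈ sumℓ es
    go (no ∄)                        = contradiction (es , unique , es⇔P) ∄
    go (yes (fs , unique′ , fs⇔P)) = sumℓ-↭ (∼bag⇒↭ (unique∧set⇒bag unique′ unique
      (λ {e} → ⇔-trans (fs⇔P e) (⇔-sym (es⇔P e)))))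

  -- The common edges are those whose target is at or before the meet, which are the edges of the
  -- path to it.
  ⟨⟩-meet : ∀ {ρ σ m} → IsMeet ρ σ m → ⟨ ρ , σ ⟩ ≈ height m
  ⟨⟩-meet {ρ} {σ} {m} (ρm , σm , greatest) = ∑ℓ-enumerated (edgesTo-unique m , λ e → mk⇔
    (λ e∈ → let e≼m = to ∈-edgesTo e∈ in
       from (E⇔On ρ) (ρ.lower e≼m ρm) , from (E⇔On σ) (σ.lower e≼m σm))
    (λ { (ρe , σe) → from ∈-edgesTo (greatest (to (E⇔On ρ) ρe) (to (E⇔On σ) σe)) }))
    where
    module ρ = MaximalChain (On-maximalChain ρ)
    module σ = MaximalChain (On-maximalChain σ)

  height-nonneg : ∀ u → 0# ≤ height u
  height-nonneg u = ≤-trans (inj₂ (≈-sym height-root)) (height-mono (root≼ u))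

  productSpace : ProductSpace ℝ v
  productSpace = record
    { X             = ∂̃
    ; _∼_           = _≈∂_
    ; isEquivalence = record
      { refl  = On⇒≈∂ id id
      ; sym   = ≈∂-sym
      ; trans = λ p q → On⇒≈∂ (≈∂⇒On q ∘ ≈∂⇒On p) (≈∂⇒On (≈∂-sym p) ∘ ≈∂⇒On (≈∂-sym q))
      }
    ; _∼?_          = λ _ _ → em
    ; p             = ⟨_,_⟩
    ; p-nonneg      = λ ρ≉σ → let m , meet = ∃-meet em ρ≉σ in
        ≤-trans (height-nonneg m) (inj₂ (≈-sym (⟨⟩-meet meet)))
    ; p-sym         = λ ρ≉σ → let m , meet@(ρm , σm , greatest) = ∃-meet em ρ≉σ in
        ≈-trans (⟨⟩-meet meet) (≈-sym (⟨⟩-meet (σm , ρm , λ σu ρu → greatest ρu σu)))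
    ; p-congʳ       = λ ρ≉σ σ≈τ → let m , meet@(ρm , σm , greatest) = ∃-meet em ρ≉σ in
        ≈-trans (⟨⟩-meet meet) (≈-sym (⟨⟩-meet
          (ρm , ≈∂⇒On σ≈τ σm , λ ρu τu → greatest ρu (≈∂⇒On (≈∂-sym σ≈τ) τu))))
    ; p-ultrametric = ultrametric
    }
    where
    -- The meets of `ρ`, `σ` and of `σ`, `τ` both lie on `σ`, so they are comparable. The lower one
    -- lies on all three paths, hence at or before the meet of `ρ` and `τ`.
    ultrametric : ∀ {ρ σ τ} → ¬ ρ ≈∂ σ → ¬ σ ≈∂ τ → ¬ ρ ≈∂ τ →
                  ⟨ ρ , σ ⟩ ≤ ⟨ ρ , τ ⟩ ⊎ ⟨ σ , τ ⟩ ≤ ⟨ ρ , τ ⟩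
    ultrametric {ρ} {σ} {τ} ρ≉σ σ≉τ ρ≉τ =
      let a , meetρσ@(ρa , σa , _) = ∃-meet em ρ≉σ
          b , meetστ@(σb , τb , _) = ∃-meet em σ≉τ
          c , meetρτ@(_ , _ , max) = ∃-meet em ρ≉τ
          bound : ∀ {s u} → s ≈ height u → u ≼ c → s ≤ ⟨ ρ , τ ⟩
          bound s≈u u≼c = ≤-trans (inj₂ s≈u) (≤-trans (height-mono u≼c) (inj₂ (≈-sym (⟨⟩-meet meetρτ))))
      in Sum.map
        (λ a≼b → bound (⟨⟩-meet meetρσ) (max ρa (MaximalChain.lower (On-maximalChain τ) a≼b τb)))
        (λ b≼a → bound (⟨⟩-meet meetστ) (max (MaximalChain.lower (On-maximalChain ρ) b≼a ρa) τb))
        (MaximalChain.chain (On-maximalChain σ) σa σb)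

  open GreedySequences ℝ productSpace public

  Everything : Pred ∂̃ v
  Everything _ = ⊤

  total-↭ : ∀ {x ts us} → ts ↭ us → total x ts ≈ total x us
  total-↭ ↭.refl        = ≈-refl
  total-↭ (prep t p)    = +-congˡ (total-↭ p)
  total-↭ (swap t u p)  = ≈-trans (solve 3 (λ a b c → a ⊕ (b ⊕ c) ⊜ b ⊕ (a ⊕ c)) ≈-refl _ _ _)
                                  (+-congˡ (+-congˡ (total-↭ p)))
  total-↭ (↭.trans p q) = ≈-trans (total-↭ p) (total-↭ q)

  -- A run lists its choices oldest first, `IsGreedy` latest first; freshness and totals are
  -- insensitive to the order.
  IsChoice⇔Choice : ∀ {ts us x} → ts ↭ us → IsChoice ts x ⇔ Choice Everything us x
  IsChoice⇔Choice {ts} {us} {x} ts↭us = mk⇔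
    (λ c → let module c = IsChoice c in choice tt (All.¬Any⇒All¬ us (c.fresh ∘ Any-resp-↭ us↭ts))
      λ y _ y≁ → ≤-trans (inj₂ (≈-sym (total-↭ ts↭us))) (≤-trans
        (c.minimal y (All.All¬⇒¬Any y≁ ∘ Any-resp-↭ ts↭us)) (inj₂ (total-↭ ts↭us))))
    (λ { (choice _ x≁ min) → record
      { fresh   = All.All¬⇒¬Any x≁ ∘ Any-resp-↭ ts↭us
      ; minimal = λ y fresh → ≤-trans (inj₂ (total-↭ ts↭us)) (≤-trans
          (min y tt (All.¬Any⇒All¬ us (fresh ∘ Any-resp-↭ us↭ts))) (inj₂ (≈-sym (total-↭ ts↭us))))
      } })
    where
    us↭ts = ↭-sym ts↭us

  module RunSequence (r : Run) where
    open Run r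

    latest : ℕ → List ∂̃
    latest zero    = []
    latest (suc n) = Maybe.maybe′ _∷_ id (ρ n) (latest n)

    earlier↭latest : ∀ n → earlier n ↭ latest n
    earlier↭latest zero    = ↭-refl
    earlier↭latest (suc n) = subst (_↭ latest (suc n))
      (trans (sym (catMaybes-++ (applyUpTo ρ n) (ρ n ∷ []))) (cong catMaybes (applyUpTo-∷ʳ ρ n)))
      (last (ρ n))
      where
      last : ∀ x → catMaybes (applyUpTo ρ n) ++ catMaybes (x ∷ []) ↭ Maybe.maybe′ _∷_ id x (latest n)
      last (just x) = ↭-trans (↭-sym (∷↭∷ʳ x (earlier n))) (prep x (earlier↭latest n))
      last nothing  = subst (_↭ latest n) (sym (++-identityʳ (earlier n))) (earlier↭latest n)

    chosen′ : ∀ {n x} → ρ n ≡ just x → Choice Everything (latest n) x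
    chosen′ {n} eq = to (IsChoice⇔Choice (earlier↭latest n)) (chosen n _ eq)

    maximal′ : ∀ {n x} → ρ n ≡ nothing → ¬ Choice Everything (latest n) x
    maximal′ {n} eq c = maximal n eq _ (from (IsChoice⇔Choice (earlier↭latest n)) c)

    latest-greedy : ∀ n → IsGreedy Everything (latest n)
    latest-greedy zero = []
    latest-greedy (suc n) with ρ n in eq
    ... | just x  = chosen′ eq ∷ latest-greedy n
    ... | nothing = latest-greedy n

-- Transport of boundaries and greedy sequences along an isometry.

module _ (ℝ : CompleteOrderedField) {v : Level} (em : ExcludedMiddle v) where
  open OrderedField ℝ

  -- What an isometry of realizations preserves, as a relation so that it can
  -- be reversed.
  record Correspondence (T₁ T₂ : LengthTree ℝ v) : Set (lsuc v) where
    private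
      module M₁ = RealizationMetric ℝ em T₁
      module M₂ = RealizationMetric ℝ em T₂
      module Γ₁ = Realization ℝ T₁
      module Γ₂ = Realization ℝ T₂
    infix 4 _≍_
    field
      _≍_    : Γ₁.Point → Γ₂.Point → Set v
      totalˡ : ∀ x → ∃ λ y → x ≍ y
      totalʳ : ∀ y → ∃ λ x → x ≍ y
      ≍-h    : ∀ {x y} → x ≍ y → M₁.h x ≈ M₂.h y
      ≍-⊑    : ∀ {x y x′ y′} → x ≍ y → x′ ≍ y′ → x M₁.⊑ x′ ⇔ y M₂.⊑ y′

  reverse : ∀ {T₁ T₂} → Correspondence T₁ T₂ → Correspondence T₂ T₁
  reverse C = record
    { _≍_    = λ y x → x ≍ y
    ; totalˡ = totalʳ
    ; totalʳ = totalˡ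
    ; ≍-h    = λ x≍y → ≈-sym (≍-h x≍y)
    ; ≍-⊑    = λ x≍y x′≍y′ → ⇔-sym (≍-⊑ x≍y x′≍y′)
    }
    where open Correspondence C

  isometry⇒correspondence : ∀ {T₁ T₂} → RootedIsometry ℝ T₁ T₂ → Correspondence T₁ T₂
  isometry⇒correspondence {T₁} {T₂} I = record
    { _≍_    = λ x y → I.to x Γ₂.≃ y
    ; totalˡ = λ x → I.to x , ≃₂-refl
    ; totalʳ = λ y → let x , x↦y = Bijection.surjective I.bijection y in x , x↦y ≃₁-refl
    ; ≍-h    = λ {x} x≍y → ≈-trans (to-h x) (M₂.h-≃ x≍y)
    ; ≍-⊑    = λ {x} {y} {x′} {y′} x≍y x′≍y′ → mk⇔
        (λ x⊑x′ → M₂.⊑-trans (M₂.⊑-reflexive (≃₂-sym x≍y)) (M₂.⊑-trans (to-⊑ x⊑x′) (M₂.⊑-reflexive x′≍y′)))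
        (λ y⊑y′ → from-⊑ (M₂.⊑-trans (M₂.⊑-reflexive x≍y) (M₂.⊑-trans y⊑y′ (M₂.⊑-reflexive (≃₂-sym x′≍y′)))))
    }
    where
    module I = RootedIsometry I
    module M₁ = RealizationMetric ℝ em T₁
    module M₂ = RealizationMetric ℝ em T₂
    module Γ₁ = Realization ℝ T₁
    module Γ₂ = Realization ℝ T₂
    open Setoid Γ₁.Γ using () renaming (refl to ≃₁-refl)
    open Setoid Γ₂.Γ using () renaming (refl to ≃₂-refl; sym to ≃₂-sym)
    open ≤-Reasoning

    to-h : ∀ x → M₁.h x ≈ M₂.h (I.to x)
    to-h x = M₂.distance-root (M₂.distance-≃ˡ I.rootPreserved
      (to (I.isometric _ x (M₁.h x)) (M₁.⊑⇒distance (M₁.root⊑ x)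
        (≈-trans (+-congʳ M₁.height-root) (+-identityˡ _)))))

    to-⊑ : ∀ {x y} → x M₁.⊑ y → I.to x M₂.⊑ I.to y
    to-⊑ {x} {y} x⊑y = M₂.distance⇒⊑
      (to (I.isometric x y _) (M₁.⊑⇒distance x⊑y (x+[y-x]≈y (M₁.h x) (M₁.h y))))
      (begin-equality
        M₂.h (I.to x) + (M₁.h y - M₁.h x) ≈⟨ +-congʳ (to-h x) ⟨
        M₁.h x + (M₁.h y - M₁.h x)        ≈⟨ x+[y-x]≈y (M₁.h x) (M₁.h y) ⟩
        M₁.h y                            ≈⟨ to-h y ⟩
        M₂.h (I.to y)                     ∎)

    from-⊑ : ∀ {x y} → I.to x M₂.⊑ I.to y → x M₁.⊑ y
    from-⊑ {x} {y} x⊑y = M₁.distance⇒⊑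
      (from (I.isometric x y _) (M₂.⊑⇒distance x⊑y (x+[y-x]≈y (M₂.h (I.to x)) (M₂.h (I.to y)))))
      (begin-equality
        M₁.h x + (M₂.h (I.to y) - M₂.h (I.to x))        ≈⟨ +-congʳ (to-h x) ⟩
        M₂.h (I.to x) + (M₂.h (I.to y) - M₂.h (I.to x)) ≈⟨ x+[y-x]≈y _ _ ⟩
        M₂.h (I.to y)                                   ≈⟨ to-h y ⟨
        M₁.h y                                          ∎)

  module BoundaryMap {T₁ T₂ : LengthTree ℝ v} (C : Correspondence T₁ T₂) where
    open Correspondence C
    open LengthTree T₁ using () renaming (root to root₁; ∂̃ to ∂₁; _≈∂_ to _≈₁_)
    open LengthTree T₂ using () renaming (Vertex to Vertex₂; root to root₂; ∂̃ to ∂₂; _≈∂_ to _≈₂_)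
    module O₁ = TreeOrder (LengthTree.tree T₁)
    module O₂ = TreeOrder (LengthTree.tree T₂)
    module M₁ = RealizationMetric ℝ em T₁
    module M₂ = RealizationMetric ℝ em T₂
    module Γ₁ = Realization ℝ T₁
    module Γ₂ = Realization ℝ T₂
    open M₁ using () renaming (_⊑_ to _⊑₁_; top to top₁; below to below₁)
    open M₂ using () renaming (_⊑_ to _⊑₂_; top to top₂; below to below₂)
    open O₁ using () renaming (_≼_ to _≼₁_; On to On₁)
    open O₂ using () renaming (_≼_ to _≼₂_; On to On₂)

    vertex-⊑₁ : ∀ {u w} → u ≼₁ w → Γ₁.vertex u ⊑₁ Γ₁.vertex w
    vertex-⊑₁ p = below₁ p (M₁.height-mono p)

    vertex-⊑₂ : ∀ {u w} → u ≼₂ w → Γ₂.vertex u ⊑₂ Γ₂.vertex w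
    vertex-⊑₂ p = below₂ p (M₂.height-mono p)

    infix 4 _↔∂_
    -- A point lies on a path exactly when its `top` does. All points are compared, not only
    -- vertices, because a vertex of valence two in one tree may correspond to an interior point of
    -- an edge in the other.
    _↔∂_ : ∂₁ → ∂₂ → Set v
    ρ ↔∂ τ = ∀ {x y} → x ≍ y → On₁ ρ (top₁ x) ⇔ On₂ τ (top₂ y)

    module _ (ρ : ∂₁) where
      private
        module ρ = O₁.MaximalChain (O₁.On-maximalChain ρ)

      Image : Pred Vertex₂ v
      Image u = ∃ λ x → x ≍ Γ₂.vertex u × On₁ ρ (top₁ x)

      on-⊑ : ∀ {x x′} → x ⊑₁ x′ → On₁ ρ (top₁ x′) → On₁ ρ (top₁ x)
      on-⊑ (below₁ p _) = ρ.lower p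

      -- Otherwise ρ would end strictly between the points corresponding to y
      -- and to the vertex top y.
      top∈Image : ∀ {u y} → On₁ ρ u → Γ₁.vertex u ≍ y → Image (top₂ y)
      top∈Image {u} {y} ρu u≍y with totalʳ (Γ₂.vertex (top₂ y))
      ... | x , x≍top = x , x≍top , O₁.byContradiction em λ ¬ρx →
        ¬ρx (ρ.maximal λ {u′} ρu′ → O₁.byContradiction em λ u′⋠x → ¬ρx (beyond ρu′ u′⋠x (ρ.chain ρu ρu′)))
        where
        u⊑x : Γ₁.vertex u ⊑₁ x
        u⊑x = from (≍-⊑ u≍y x≍top) (M₂.⊑-top y)

        beyond : ∀ {u′} → On₁ ρ u′ → ¬ u′ ≼₁ top₁ x → u ≼₁ u′ ⊎ u′ ≼₁ u → On₁ ρ (top₁ x)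
        beyond ρu′ u′⋠x (inj₂ u′≼u) = contradiction (O₁.≼-trans u′≼u (M₁._⊑_.top≼ u⊑x)) u′⋠x
        beyond {u′} ρu′ u′⋠x (inj₁ u≼u′) with totalˡ (Γ₁.vertex u′)
        -- If `y′` had the same top as `y`, then `u′` would be below `x`. So `top₂ y` is strictly
        -- below `top₂ y′`, the vertex `top₂ y` precedes `y′`, and `x` precedes `u′`.
        ... | y′ , u′≍y′ = on-⊑ (from (≍-⊑ x≍top u′≍y′)
              (M₂.⊑-strict (M₂._⊑_.top≼ (to (≍-⊑ u≍y u′≍y′) (vertex-⊑₁ u≼u′))) λ top≡ →
                u′⋠x (M₁._⊑_.top≼ (from (≍-⊑ u′≍y′ x≍top)
                  (subst (λ w → y′ ⊑₂ Γ₂.vertex w) (sym top≡) (M₂.⊑-top y′))))))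
              ρu′

      Image-maximalChain : O₂.MaximalChain Image
      Image-maximalChain = record
        { root∈   = let x , x≍r  = totalʳ (Γ₂.vertex root₂)
                        y , r≍y  = totalˡ (Γ₁.vertex root₁)
                    in x , x≍r , on-⊑ (from (≍-⊑ x≍r r≍y) (M₂.root⊑ y)) ρ.root∈
        ; lower   = λ { {u} u≼w (x , x≍w , ρx) → let x′ , x′≍u = totalʳ (Γ₂.vertex u) in
                        x′ , x′≍u , on-⊑ (from (≍-⊑ x′≍u x≍w) (vertex-⊑₂ u≼w)) ρx }
        ; chain   = λ { (x , x≍u , ρx) (x′ , x′≍w , ρx′) → Sum.map
                        (λ x⊑x′ → M₂._⊑_.top≼ (to (≍-⊑ x≍u x′≍w) x⊑x′))
                        (λ x′⊑x → M₂._⊑_.top≼ (to (≍-⊑ x′≍w x≍u) x′⊑x))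
                        (M₁.⊑-connex (ρ.chain ρx ρx′)) }
        ; maximal = λ {w} above → let x , x≍w = totalʳ (Γ₂.vertex w) in
            x , x≍w , ρ.maximal λ {u} ρu → let y , u≍y = totalˡ (Γ₁.vertex u) in
              M₁._⊑_.top≼ (from (≍-⊑ u≍y x≍w)
                (M₂.⊑-trans (M₂.⊑-top y) (vertex-⊑₂ (above (top∈Image ρu u≍y)))))
        }

      ∃-image : ∃ λ τ → ρ ↔∂ τ
      ∃-image with O₂.∃-path em Image-maximalChain
      ... | τ , τ⇔Image = τ , λ {x} {y} x≍y → mk⇔
        (λ ρx → let y′ , top≍y′ = totalˡ (Γ₁.vertex (top₁ x)) in
          from τ⇔Image (O₂.MaximalChain.lower Image-maximalChain
            (M₂._⊑_.top≼ (to (≍-⊑ x≍y top≍y′) (M₁.⊑-top x))) (top∈Image ρx top≍y′)))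
        (λ τy → let x′ , x′≍top , ρx′ = to τ⇔Image τy in
          on-⊑ (from (≍-⊑ x≍y x′≍top) (M₂.⊑-top y)) ρx′)

    ↔∂-≈ : ∀ {ρ ρ′ τ τ′} → ρ ↔∂ τ → ρ′ ↔∂ τ′ → ρ ≈₁ ρ′ → τ ≈₂ τ′
    ↔∂-≈ {ρ} {ρ′} {τ} {τ′} R R′ ρ≈ρ′ = O₂.On⇒≈∂
      (λ {u} τu → let x , x≍u = totalʳ (Γ₂.vertex u) in to (R′ x≍u) (O₁.≈∂⇒On ρ≈ρ′ (from (R x≍u) τu)))
      (λ {u} τ′u → let x , x≍u = totalʳ (Γ₂.vertex u) in
        to (R x≍u) (O₁.≈∂⇒On (O₁.≈∂-sym ρ≈ρ′) (from (R′ x≍u) τ′u)))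

    -- The point corresponding to `m` has its top on both `τ` and `τ′`, hence at or before `n`. The
    -- reversed correspondence gives the opposite inequality.
    meet-≤ : ∀ {ρ ρ′ τ τ′ m n} → ρ ↔∂ τ → ρ′ ↔∂ τ′ → O₁.IsMeet ρ ρ′ m → O₂.IsMeet τ τ′ n →
             M₁.height m ≤ M₂.height n
    meet-≤ {m = m} {n} R R′ (ρm , ρ′m , _) (_ , _ , greatest) with totalˡ (Γ₁.vertex m)
    ... | y , m≍y = begin
      M₁.height m         ≈⟨ ≍-h m≍y ⟩
      M₂.h y              ≤⟨ M₂.h≤height-top y ⟩
      M₂.height (top₂ y)  ≤⟨ M₂.height-mono (greatest (to (R m≍y) ρm) (to (R′ m≍y) ρ′m)) ⟩
      M₂.height n         ∎
      where open ≤-Reasoning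

  module Comparison {T₁ T₂ : LengthTree ℝ v} (C : Correspondence T₁ T₂) where
    open BoundaryMap C
    module Reverse = BoundaryMap (reverse C)
    module G₁ = ExtendedBoundary ℝ em T₁
    module G₂ = ExtendedBoundary ℝ em T₂
    open LengthTree T₁ using () renaming (_≈∂_ to _≈₁_)
    open LengthTree T₂ using () renaming (_≈∂_ to _≈₂_)
    open Greedy ℝ em T₁ using () renaming (⟨_,_⟩ to ⟨_,_⟩₁)
    open Greedy ℝ em T₂ using () renaming (⟨_,_⟩ to ⟨_,_⟩₂)

    ↔∂-≈⁻ : ∀ {ρ ρ′ τ τ′} → ρ ↔∂ τ → ρ′ ↔∂ τ′ → τ ≈₂ τ′ → ρ ≈₁ ρ′
    ↔∂-≈⁻ R R′ = Reverse.↔∂-≈ (⇔-sym ∘ R) (⇔-sym ∘ R′)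

    ⟨⟩-↔∂ : ∀ {ρ ρ′ τ τ′} → ρ ↔∂ τ → ρ′ ↔∂ τ′ → ¬ ρ ≈₁ ρ′ → ⟨ ρ , ρ′ ⟩₁ ≈ ⟨ τ , τ′ ⟩₂
    ⟨⟩-↔∂ R R′ ρ≉ρ′ =
      let m , meet₁ = O₁.∃-meet em ρ≉ρ′
          n , meet₂ = O₂.∃-meet em (ρ≉ρ′ ∘ ↔∂-≈⁻ R R′)
      in ≈-trans (G₁.⟨⟩-meet meet₁) (≈-trans
           (≤-antisym (meet-≤ R R′ meet₁ meet₂) (Reverse.meet-≤ (⇔-sym ∘ R) (⇔-sym ∘ R′) meet₂ meet₁))
           (≈-sym (G₂.⟨⟩-meet meet₂)))

    tot-↔∂ : ∀ {ρ τ ρs τs} → ρ ↔∂ τ → PointwiseList _↔∂_ ρs τs → G₁.Apart ρ ρs →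
             G₁.tot ρ ρs ≈ G₂.tot τ τs
    tot-↔∂ R []        []        = ≈-refl
    tot-↔∂ R (R′ ∷ Rs) (≉ ∷ ≉s) = +-cong (⟨⟩-↔∂ R R′ ≉) (tot-↔∂ R Rs ≉s)

    Apart-↔∂ : ∀ {ρ τ ρs τs} → ρ ↔∂ τ → PointwiseList _↔∂_ ρs τs → G₁.Apart ρ ρs → G₂.Apart τ τs
    Apart-↔∂ R []        []        = []
    Apart-↔∂ R (R′ ∷ Rs) (≉ ∷ ≉s) = (≉ ∘ ↔∂-≈⁻ R R′) ∷ Apart-↔∂ R Rs ≉s

    Apart-↔∂⁻ : ∀ {ρ τ ρs τs} → ρ ↔∂ τ → PointwiseList _↔∂_ ρs τs → G₂.Apart τ τs → G₁.Apart ρ ρs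
    Apart-↔∂⁻ R []        []        = []
    Apart-↔∂⁻ R (R′ ∷ Rs) (≉ ∷ ≉s) = (≉ ∘ ↔∂-≈ R R′) ∷ Apart-↔∂⁻ R Rs ≉s

    -- Every competitor in the second boundary corresponds to one in the first with the same total.
    Choice-↔∂ : ∀ {ρ τ ρs τs} → ρ ↔∂ τ → PointwiseList _↔∂_ ρs τs →
                G₁.Choice G₁.Everything ρs ρ → G₂.Choice G₂.Everything τs τ
    Choice-↔∂ {ρ} {τ} {ρs} {τs} R Rs (G₁.choice _ ρ≉ min) = G₂.choice tt (Apart-↔∂ R Rs ρ≉) λ σ _ σ≉ →
      let π , Rσ = Reverse.∃-image σ
          π≉     = Apart-↔∂⁻ (⇔-sym ∘ Rσ) Rs σ≉
      in begin
        G₂.tot τ τs ≈⟨ tot-↔∂ R Rs ρ≉ ⟨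
        G₁.tot ρ ρs ≤⟨ min π tt π≉ ⟩
        G₁.tot π ρs ≈⟨ tot-↔∂ (⇔-sym ∘ Rσ) Rs π≉ ⟩
        G₂.tot σ τs ∎
      where open ≤-Reasoning

    ∃-greedyImage : ∀ {ρs} → G₁.IsGreedy G₁.Everything ρs →
                    ∃ λ τs → PointwiseList _↔∂_ ρs τs × G₂.IsGreedy G₂.Everything τs
    ∃-greedyImage G₁.[]            = [] , [] , G₂.[]
    ∃-greedyImage (G₁._∷_ {ρ} c g) =
      let τ  , R       = ∃-image ρ
          τs , Rs , g′ = ∃-greedyImage g
      in τ ∷ τs , R ∷ Rs , Choice-↔∂ R Rs c G₂.∷ g′

    -- The image of `ρs` is a greedy list in the second boundary, so it and `τs` can be compared
    -- inside one product space.
    transfer : ∀ {ρs τs ρ} → G₁.IsGreedy G₁.Everything ρs → G₂.IsGreedy G₂.Everything τs →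
               length ρs ≡ length τs → G₁.Choice G₁.Everything ρs ρ →
               ∃ λ τ → G₂.Choice G₂.Everything τs τ × G₂.tot τ τs ≈ G₁.tot ρ ρs
    transfer {ρ = ρ} g₁ g₂ eq c =
      let σs , Rs , g = ∃-greedyImage g₁
          σ  , R      = ∃-image ρ
          τ , c′ , eq′ = G₂.transferChoice g₂ g (trans (sym eq) (Pointwise-length Rs)) (Choice-↔∂ R Rs c)
      in τ , c′ , ≈-trans eq′ (≈-sym (tot-↔∂ R Rs (G₁.Choice.apart c)))

theorem1p1 : ∀ {v : Level} (em : ExcludedMiddle v) (ℝ : CompleteOrderedField)
    (T₁ T₂ : LengthTree ℝ v) → RootedIsometry ℝ T₁ T₂ →
    (r₁ : Greedy.Run ℝ em T₁) (r₂ : Greedy.Run ℝ em T₂) →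
    ∀ (n : ℕ) → Pointwise (CompleteOrderedField._≈_ ℝ)
    (Greedy.Run.a r₁ n) (Greedy.Run.a r₂ n)
theorem1p1 em ℝ T₁ T₂ isometry r₁ r₂ = sameValue
  where
  open OrderedField ℝ
  C = isometry⇒correspondence ℝ em isometry
  module C₁₂ = Comparison ℝ em C
  module C₂₁ = Comparison ℝ em (reverse ℝ em C)
  module G₁ = ExtendedBoundary ℝ em T₁
  module G₂ = ExtendedBoundary ℝ em T₂
  module R₁ = G₁.RunSequence r₁
  module R₂ = G₂.RunSequence r₂
  open Greedy.Run r₁ using () renaming (ρ to ρ₁)
  open Greedy.Run r₂ using () renaming (ρ to ρ₂)

  -- A choice in the first run transfers to one for the second, which therefore cannot have stopped.
  continues₂ : ∀ {n x} → length (R₁.latest n) ≡ length (R₂.latest n) → ρ₁ n ≡ just x → ρ₂ n ≢ nothing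
  continues₂ {n} eq eq₁ eq₂ =
    let _ , c , _ = C₁₂.transfer (R₁.latest-greedy n) (R₂.latest-greedy n) eq (R₁.chosen′ eq₁)
    in R₂.maximal′ eq₂ c

  continues₁ : ∀ {n x} → length (R₁.latest n) ≡ length (R₂.latest n) → ρ₂ n ≡ just x → ρ₁ n ≢ nothing
  continues₁ {n} eq eq₂ eq₁ =
    let _ , c , _ = C₂₁.transfer (R₂.latest-greedy n) (R₁.latest-greedy n) (sym eq) (R₂.chosen′ eq₂)
    in R₁.maximal′ eq₁ c

  sameLength : ∀ n → length (R₁.latest n) ≡ length (R₂.latest n)
  sameLength zero = refl
  sameLength (suc n) with ρ₁ n in eq₁ | ρ₂ n in eq₂
  ... | just _  | just _  = cong suc (sameLength n)
  ... | nothing | nothing = sameLength n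
  ... | just _  | nothing = contradiction eq₂ (continues₂ (sameLength n) eq₁)
  ... | nothing | just _  = contradiction eq₁ (continues₁ (sameLength n) eq₂)

  sameValue : ∀ n → Pointwise _≈_ (Greedy.Run.a r₁ n) (Greedy.Run.a r₂ n)
  sameValue n with ρ₁ n in eq₁ | ρ₂ n in eq₂
  ... | nothing | nothing = nothing
  ... | just _  | nothing = contradiction eq₂ (continues₂ (sameLength n) eq₁)
  ... | nothing | just _  = contradiction eq₁ (continues₁ (sameLength n) eq₂)
  -- The transferred choice has the total of `ρ`. It need not be `τ`, but two choices for the same
  -- list have equal totals.
  ... | just ρ  | just τ  =
    let _ , c , eq = C₁₂.transfer (R₁.latest-greedy n) (R₂.latest-greedy n) (sameLength n) (R₁.chosen′ eq₁)
    in just (begin-equality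
         Greedy.total ℝ em T₁ ρ (Greedy.Run.earlier r₁ n) ≈⟨ G₁.total-↭ (R₁.earlier↭latest n) ⟩
         G₁.tot ρ (R₁.latest n)                           ≈⟨ eq ⟨
         G₂.tot _ (R₂.latest n)                           ≈⟨ G₂.choice-unique c (R₂.chosen′ eq₂) ⟩
         G₂.tot τ (R₂.latest n)                           ≈⟨ G₂.total-↭ (R₂.earlier↭latest n) ⟨
         Greedy.total ℝ em T₂ τ (Greedy.Run.earlier r₂ n) ∎)
    where open ≤-Reasoning
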